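{- Let $n$ be a positive integer, let $m_1,\dots,m_n$ be integers, and let $m$ be such that $2\le m_i\le m$ for $i=1,\dots,n$. Then \[r_3(\mathbb{Z}_{m_1}\times\dots\times\mathbb{Z}_{m_n})\ge \frac{(7/24)^{n/2}}{10^{6}m^2n^3}\cdot m_1\cdots m_n.\]
   Context: For a finite abelian group $G$, $r_3(G)$ denotes the maximum possible size of a subset $A\subseteq G$ such that there do not exist distinct $x,y,z\in A$ with $x+z=y+y$. $\mathbb{Z}_k$ denotes the cyclic group $\mathbb{Z}/k\mathbb{Z}$. -}

module Defs where

open import Data.Nat using (ℕ; zero; suc; _+_; _*_; _^_; _≤_)
open import Data.Nat.DivMod using (_mod_)
open import Data.Fin using (Fin; toℕ)
open import Data.List using (List; length)
open import Data.List.Membership.Propositional using (_∈_)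
open import Data.List.Relation.Unary.AllPairs using (AllPairs)
open import Data.Product using (_×_; Σ; ∃-syntax)
open import Relation.Binary.PropositionalEquality using (_≡_)
open import Relation.Nullary using (¬_)

addMod : ∀ {k} → Fin k → Fin k → Fin k
addMod {suc k} x y = (toℕ x + toℕ y) mod (suc k)

Grp : (n : ℕ) → (Fin n → ℕ) → Set
Grp n ms = (i : Fin n) → Fin (ms i)

_⊕_ : ∀ {n} {ms : Fin n → ℕ} → Grp n ms → Grp n ms → Grp n ms
(x ⊕ y) i = addMod (x i) (y i)

_≈G_ : ∀ {n} {ms : Fin n → ℕ} → Grp n ms → Grp n ms → Set
x ≈G y = ∀ i → x i ≡ y i

-- A finite subset A of the group, given as a duplicate-free list.
IsSubset : ∀ {n} {ms : Fin n → ℕ} → List (Grp n ms) → Set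
IsSubset {n} {ms} A = AllPairs (λ x y → ¬ (_≈G_ {n} {ms} x y)) A

ThreeAPFree : ∀ {n} {ms : Fin n → ℕ} → List (Grp n ms) → Set
ThreeAPFree {n} {ms} A =
  ∀ x y z → x ∈ A → y ∈ A → z ∈ A →
  ¬ (_≈G_ {n} {ms} x y) → ¬ (_≈G_ {n} {ms} y z) → ¬ (_≈G_ {n} {ms} x z) →
  ¬ (_≈G_ {n} {ms} (x ⊕ z) (y ⊕ y))

prodFin : (n : ℕ) → (Fin n → ℕ) → ℕ
prodFin zero f = 1
prodFin (suc n) f = f Fin.zero * prodFin n (λ i → f (Fin.suc i))

{-# OPTIONS --safe #-}
module Submission where

-- Behrend's argument, with a two-dimensional block that is denser than a
-- quarter of the torus.  Call a weighted set convex if x + z = 2y in it forces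
-- w(x) + w(z) ≥ 2 w(y), with equality only for x = z.  Products of convex sets
-- (adding the weights) are convex and the level sets of w contain no
-- progression, so by pigeonhole it suffices to find, in each ℤ_m₁ × ℤ_m₂, a
-- convex set of density 7/24 whose weights are O(m²).
--
-- Such a set is cut out of the torus ℝ/400 × ℝ/240, averaging over translates.
-- The inner region, |c - 200| < width t for t < 120, fits into a quarter of the
-- torus, so its progressions do not wrap and the weight is quadratic.  The outer
-- region, |c - 100| or |c - 300| < bulge (t - 121) for t ≥ 121, is invariant
-- under c ↦ c + 200; its progressions wrap only by exchanging the two halves,
-- on which the weight agrees.  Outer weights exceed inner ones and grow steeply
-- with t, so a progression with outer midpoint and inner endpoint can only be bad
-- if t₁ + t₃ + 240 ≈ 2 t₂, and there the widths are such that the c-coordinates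
-- cannot match.

open import Defs
open import Data.Bool using (true; false; if_then_else_; T)
open import Data.Empty using (⊥; ⊥-elim)
open import Data.Fin using (Fin; toℕ; inject≤; _↑ˡ_; _↑ʳ_)
open import Data.Fin.Properties using (toℕ<n; toℕ-fromℕ<; toℕ-injective; toℕ-inject≤)
open import Data.List using (List; []; _∷_; _++_; length; map; filter; tabulate; allFin; cartesianProduct)
open import Data.List.Membership.Propositional using (_∈_)
open import Data.List.Membership.Propositional.Properties using (∈-map⁻; ∈-filter⁻; ∈-cartesianProduct⁻)
open import Data.List.Properties using (length-map; length-++; length-tabulate; filter-++; map-tabulate)
open import Data.List.Relation.Unary.All using ([])
import Data.List.Relation.Unary.AllPairs as AllPairs
import Data.List.Relation.Unary.AllPairs.Properties as AllPairs
open import Data.List.Relation.Unary.Unique.Propositional using (Unique)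
import Data.List.Relation.Unary.Unique.Propositional.Properties as Unique
open import Data.Nat
open import Data.Nat.Divisibility using (divides-refl)
open import Data.Nat.DivMod
open import Data.Nat.Properties
open import Data.Nat.Tactic.RingSolver using (solve; solve-∀)
open import Data.Product using (Σ; ∃; _×_; _,_; proj₁; proj₂)
open import Data.Sum using (_⊎_; inj₁; inj₂; [_,_]′)
open import Data.Unit using (⊤; tt)
open import Function using (_∘_; id)
open import Relation.Binary.Definitions using (tri<; tri≈; tri>)
open import Relation.Binary.PropositionalEquality
open import Relation.Nullary using (¬_; Dec; yes; no; does)
open import Relation.Nullary.Decidable using (map′; _×-dec_; _⊎-dec_)
open import Relation.Unary using (Pred; Decidable)

-- Finite sums and counting

∑ : ℕ → (ℕ → ℕ) → ℕ
∑ zero    f = 0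
∑ (suc n) f = f 0 + ∑ n (f ∘ suc)

∑-cong : ∀ n {f g} → (∀ i → i < n → f i ≡ g i) → ∑ n f ≡ ∑ n g
∑-cong zero    f≗g = refl
∑-cong (suc n) f≗g = cong₂ _+_ (f≗g 0 z<s) (∑-cong n λ i i<n → f≗g (suc i) (s<s i<n))

∑-const : ∀ n c → ∑ n (λ _ → c) ≡ n * c
∑-const zero    c = refl
∑-const (suc n) c = cong (c +_) (∑-const n c)

∑-+ : ∀ n f g → ∑ n (λ i → f i + g i) ≡ ∑ n f + ∑ n g
∑-+ zero    f g = refl
∑-+ (suc n) f g = trans (cong (f 0 + g 0 +_) (∑-+ n (f ∘ suc) (g ∘ suc)))
  (lemma (f 0) (g 0) (∑ n (f ∘ suc)) (∑ n (g ∘ suc)))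
  where
  lemma : ∀ a b c d → a + b + (c + d) ≡ (a + c) + (b + d)
  lemma = solve-∀

∑-* : ∀ n c f → ∑ n (λ i → c * f i) ≡ c * ∑ n f
∑-* zero    c f = sym (*-zeroʳ c)
∑-* (suc n) c f = trans (cong (c * f 0 +_) (∑-* n c (f ∘ suc))) (sym (*-distribˡ-+ c (f 0) _))

∑-swap : ∀ a b (f : ℕ → ℕ → ℕ) → ∑ a (λ i → ∑ b (f i)) ≡ ∑ b (λ j → ∑ a (λ i → f i j))
∑-swap zero    b f = sym (trans (∑-const b 0) (*-zeroʳ b))
∑-swap (suc a) b f = trans (cong (∑ b (f 0) +_) (∑-swap a b (f ∘ suc)))
  (sym (∑-+ b (f 0) (λ j → ∑ a (λ i → f (suc i) j))))

∑-split : ∀ a b f → ∑ (a + b) f ≡ ∑ a f + ∑ b (λ i → f (a + i))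
∑-split zero    b f = refl
∑-split (suc a) b f = trans (cong (f 0 +_) (∑-split a b (f ∘ suc))) (sym (+-assoc (f 0) _ _))

∑-blocks : ∀ a b f → ∑ (a * b) f ≡ ∑ a (λ i → ∑ b (λ j → f (i * b + j)))
∑-blocks zero    b f = refl
∑-blocks (suc a) b f = trans (∑-split b (a * b) f) (cong (∑ b f +_)
  (trans (∑-blocks a b (λ i → f (b + i)))
    (∑-cong a λ i _ → ∑-cong b λ j _ → cong f (sym (+-assoc b (i * b) j)))))

-- The points N k + s (k < m, s < N) run through [0, N m), which meets each of
-- the N cells of length m in exactly m points.
∑-shifts : ∀ N m .{{_ : NonZero m}} (g : ℕ → ℕ) →
  ∑ N (λ s → ∑ m (λ k → g ((N * k + s) / m))) ≡ m * ∑ N g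
∑-shifts N m g = begin
  ∑ N (λ s → ∑ m (λ k → g ((N * k + s) / m)))
    ≡⟨ ∑-swap N m (λ s k → g ((N * k + s) / m)) ⟩
  ∑ m (λ k → ∑ N (λ s → g ((N * k + s) / m)))
    ≡⟨ ∑-cong m (λ k _ → ∑-cong N λ s _ → cong (λ a → g ((a + s) / m)) (*-comm N k)) ⟩
  ∑ m (λ k → ∑ N (λ s → g ((k * N + s) / m)))
    ≡⟨ ∑-blocks m N (λ i → g (i / m)) ⟨
  ∑ (m * N) (λ i → g (i / m))
    ≡⟨ cong (λ a → ∑ a (λ i → g (i / m))) (*-comm m N) ⟩
  ∑ (N * m) (λ i → g (i / m))
    ≡⟨ ∑-blocks N m (λ i → g (i / m)) ⟩
  ∑ N (λ i → ∑ m (λ j → g ((i * m + j) / m)))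
    ≡⟨ ∑-cong N (λ i _ → ∑-cong m λ j j<m → cong g (quotient i j j<m)) ⟩
  ∑ N (λ i → ∑ m (λ _ → g i))
    ≡⟨ ∑-cong N (λ i _ → ∑-const m (g i)) ⟩
  ∑ N (λ i → m * g i)
    ≡⟨ ∑-* N m g ⟩
  m * ∑ N g ∎
  where
  open ≡-Reasoning
  quotient : ∀ i j → j < m → (i * m + j) / m ≡ i
  quotient i j j<m = trans (+-distrib-/-∣ˡ j (divides-refl i))
    (trans (cong₂ _+_ (m*n/n≡m i m) (m<n⇒m/n≡0 j<m)) (+-identityʳ i))

∑-max : ∀ n .{{_ : NonZero n}} f → ∃ λ i → i < n × ∑ n f ≤ n * f i
∑-max (suc zero)    f = 0 , z<s , ≤-refl
∑-max (suc (suc n)) f with ∑-max (suc n) (f ∘ suc)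
... | i , i<n , ≤i with ≤-total (f 0) (f (suc i))
...   | inj₁ f0≤ = suc i , s<s i<n , +-mono-≤ f0≤ ≤i
...   | inj₂ ≤f0 = 0 , z<s , +-monoʳ-≤ (f 0) (≤-trans ≤i (*-monoʳ-≤ (suc n) ≤f0))

∑-max₂ : ∀ a b .{{_ : NonZero a}} .{{_ : NonZero b}} (f : ℕ → ℕ → ℕ) →
  ∃ λ i → ∃ λ j → i < a × j < b × ∑ a (λ i → ∑ b (f i)) ≤ a * (b * f i j)
∑-max₂ a b f with ∑-max a (λ i → ∑ b (f i))
... | i , i<a , ≤i with ∑-max b (f i)
...   | j , j<b , ≤j = i , j , i<a , j<b , ≤-trans ≤i (*-monoʳ-≤ a ≤j)

𝟙 : ∀ {a} {A : Set a} → Dec A → ℕ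
𝟙 d = if does d then 1 else 0

module _ {a p} {A : Set a} {P : Pred A p} (P? : Decidable P) where

  length-filter-∷ : ∀ x xs → length (filter P? (x ∷ xs)) ≡ 𝟙 (P? x) + length (filter P? xs)
  length-filter-∷ x xs with does (P? x)
  ... | true  = refl
  ... | false = refl

  length-filter-++ : ∀ xs ys → length (filter P? (xs ++ ys)) ≡ length (filter P? xs) + length (filter P? ys)
  length-filter-++ xs ys = trans (cong length (filter-++ P? xs ys)) (length-++ (filter P? xs))

  length-filter-tabulate : ∀ n (x : Fin n → A) (h : ℕ → ℕ) → (∀ i → 𝟙 (P? (x i)) ≡ h (toℕ i)) →
    length (filter P? (tabulate x)) ≡ ∑ n h
  length-filter-tabulate zero    x h eq = refl
  length-filter-tabulate (suc n) x h eq = trans (length-filter-∷ _ _)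
    (cong₂ _+_ (eq Fin.zero) (length-filter-tabulate n (x ∘ Fin.suc) (h ∘ suc) (eq ∘ Fin.suc)))

module _ {a b p} {A : Set a} {B : Set b} {P : Pred (A × B) p} (P? : Decidable P) where

  length-filter-cartesianProduct : ∀ m n (x : Fin m → A) (y : Fin n → B) (h : ℕ → ℕ → ℕ) →
    (∀ i j → 𝟙 (P? (x i , y j)) ≡ h (toℕ i) (toℕ j)) →
    length (filter P? (cartesianProduct (tabulate x) (tabulate y))) ≡ ∑ m (λ i → ∑ n (h i))
  length-filter-cartesianProduct zero    n x y h eq = refl
  length-filter-cartesianProduct (suc m) n x y h eq = trans
    (length-filter-++ P? (map (x Fin.zero ,_) (tabulate y)) _)
    (cong₂ _+_
      (trans (cong (length ∘ filter P?) (map-tabulate y (x Fin.zero ,_)))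
        (length-filter-tabulate P? n (λ j → x Fin.zero , y j) (h 0) (eq Fin.zero)))
      (length-filter-cartesianProduct m n (x ∘ Fin.suc) y (h ∘ suc) (eq ∘ Fin.suc)))

∑-fibres : ∀ {a} {A : Set a} (v : A → ℕ) N xs → (∀ x → v x < N) →
  ∑ N (λ k → length (filter (λ x → v x ≟ k) xs)) ≡ length xs
∑-fibres v N []       v<N = trans (∑-const N 0) (*-zeroʳ N)
∑-fibres v N (x ∷ xs) v<N = begin
  ∑ N (λ k → length (filter (λ x → v x ≟ k) (x ∷ xs)))
    ≡⟨ ∑-cong N (λ k _ → length-filter-∷ (λ x → v x ≟ k) x xs) ⟩
  ∑ N (λ k → 𝟙 (v x ≟ k) + length (filter (λ x → v x ≟ k) xs))
    ≡⟨ ∑-+ N (λ k → 𝟙 (v x ≟ k)) _ ⟩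
  ∑ N (λ k → 𝟙 (v x ≟ k)) + ∑ N (λ k → length (filter (λ x → v x ≟ k) xs))
    ≡⟨ cong₂ _+_ (single N (v x) (v<N x)) (∑-fibres v N xs v<N) ⟩
  suc (length xs) ∎
  where
  open ≡-Reasoning
  single : ∀ N w → w < N → ∑ N (λ k → 𝟙 (w ≟ k)) ≡ 1
  single (suc N) zero    _         = cong suc (trans (∑-const N 0) (*-zeroʳ N))
  single (suc N) (suc w) (s<s w<N) = single N w w<N

-- Congruences, intervals and convexity

-- Stands in for linear arithmetic: the hypotheses are added up into `l ≤ r`, `e` is the slack, and
-- what remains is an identity for the ring solver.
≤-from : ∀ {l r x y} e → l ≤ r → x + r + e ≡ y + l → x ≤ y
≤-from {l} {r} {x} {y} e l≤r eq = m+n≤o⇒m≤o x (+-cancelʳ-≤ r (x + e) y (begin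
  x + e + r   ≡⟨ rearrange x e r ⟩
  x + r + e   ≡⟨ eq ⟩
  y + l       ≤⟨ +-monoʳ-≤ y l≤r ⟩
  y + r       ∎))
  where
  open ≤-Reasoning
  rearrange : ∀ x e r → x + e + r ≡ x + r + e
  rearrange = solve-∀

-- Multiples of `M` are allowed on both sides, which avoids subtraction in ℕ.
record Cong (M u v : ℕ) : Set where
  constructor wraps
  field
    p q : ℕ
    eq  : u + p * M ≡ v + q * M

cong-sym : ∀ {M u v} → Cong M u v → Cong M v u
cong-sym (wraps p q eq) = wraps q p (sym eq)

cong-shift : ∀ {M u v} → Cong M u v → Cong M (u + M) v
cong-shift {M} {u} {v} (wraps p q eq) = wraps p (suc q) (trans (lemma₁ u M (p * M))
  (trans (cong (_+ M) eq) (lemma₂ v M (q * M))))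
  where
  lemma₁ : ∀ u M a → u + M + a ≡ u + a + M
  lemma₁ = solve-∀
  lemma₂ : ∀ v M a → v + a + M ≡ v + (M + a)
  lemma₂ = solve-∀

-- Unequal `p` and `q` would put `u` and `v` at least `M` apart.
cong-≡ : ∀ {M u v} → Cong M u v → u < v + M → v < u + M → u ≡ v
cong-≡ {M} {u} {v} (wraps p q eq) u<v+M v<u+M with <-cmp p q
... | tri≈ _ refl _ = +-cancelʳ-≡ (p * M) u v eq
... | tri< p<q _ _  = ⊥-elim (<-irrefl eq (begin-strict
  u + p * M        <⟨ +-monoˡ-< (p * M) u<v+M ⟩
  v + M + p * M    ≡⟨ +-assoc v M (p * M) ⟩
  v + suc p * M    ≤⟨ +-monoʳ-≤ v (*-monoˡ-≤ M p<q) ⟩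
  v + q * M        ∎))
  where open ≤-Reasoning
... | tri> _ _ q<p  = ⊥-elim (<-irrefl (sym eq) (begin-strict
  v + q * M        <⟨ +-monoˡ-< (q * M) v<u+M ⟩
  u + M + q * M    ≡⟨ +-assoc u M (q * M) ⟩
  u + suc q * M    ≤⟨ +-monoʳ-≤ u (*-monoˡ-≤ M q<p) ⟩
  u + p * M        ∎))
  where open ≤-Reasoning

cong-gap : ∀ {M u v} → Cong M u v → u < v → v < u + M → ⊥
cong-gap {M} {u} {v} u≈v u<v v<u+M = <-irrefl (cong-≡ u≈v (<-≤-trans u<v (m≤m+n v M)) v<u+M) u<v

-- Meant for the rows of a progression with outer midpoint: the doubled midpoint lies less than two
-- turns above the sum of the endpoints, so at most one wrap is possible.
cong-≡⊎ : ∀ {M u v} → Cong M u v → u < v + M → v < u + M + M → u ≡ v ⊎ u + M ≡ v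
cong-≡⊎ {M} {u} {v} u≈v u<v+M v<u+2M with v <? u + M
... | yes v<u+M = inj₁ (cong-≡ u≈v u<v+M v<u+M)
... | no  v≮u+M = inj₂ (cong-≡ (cong-shift u≈v) (+-monoˡ-< M u<v) v<u+2M)
  where
  u<v : u < v
  u<v = ≰⇒> λ v≤u → <-irrefl refl
    (<-≤-trans u<v+M (≤-trans (+-monoˡ-≤ M v≤u) (≤-trans (≮⇒≥ v≮u+M) v≤u)))

-- x/m lies in [z - r, z + r).
record Near (m z r x : ℕ) : Set where
  constructor _,_
  field
    lower : z * m ≤ x + r * m
    upper : x < (z + r) * m

-- The endpoints `z - r` and `z + r` are integers, so membership in the interval can be read off
-- from the floor.
Near-/ : ∀ m .{{_ : NonZero m}} z r x → Near 1 z r (x / m) → Near m z r x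
Near-/ m z r x (lo , hi) = (begin
    z * m                 ≡⟨ cong (_* m) (*-identityʳ z) ⟨
    z * 1 * m             ≤⟨ *-monoˡ-≤ m lo ⟩
    (x / m + r * 1) * m   ≡⟨ cong (λ a → (x / m + a) * m) (*-identityʳ r) ⟩
    (x / m + r) * m       ≡⟨ *-distribʳ-+ m (x / m) r ⟩
    x / m * m + r * m     ≤⟨ +-monoˡ-≤ (r * m) (m/n*n≤m x m) ⟩
    x + r * m             ∎)
  , (begin-strict
    x                     ≡⟨ m≡m%n+[m/n]*n x m ⟩
    x % m + x / m * m     <⟨ +-monoˡ-< (x / m * m) (m%n<n x m) ⟩
    suc (x / m) * m       ≤⟨ *-monoˡ-≤ m hi ⟩
    (z + r) * 1 * m       ≡⟨ cong (_* m) (*-identityʳ (z + r)) ⟩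
    (z + r) * m           ∎)
  where open ≤-Reasoning

Near-+ : ∀ {m z r x z′ r′ x′} → Near m z r x → Near m z′ r′ x′ → Near m (z + z′) (r + r′) (x + x′)
Near-+ {m} {z} {r} {x} {z′} {r′} {x′} (lo , hi) (lo′ , hi′) =
  ≤-from 0 (+-mono-≤ lo lo′) (solve (m ∷ z ∷ r ∷ x ∷ z′ ∷ r′ ∷ x′ ∷ [])) ,
  -- Two strict bounds add up with one unit to spare, hence the slack `1`.
  ≤-from 1 (+-mono-≤ hi hi′) (solve (m ∷ z ∷ r ∷ x ∷ z′ ∷ r′ ∷ x′ ∷ []))

Near-shift : ∀ N {m z r x} → Near m z r x → Near m (z + N) r (x + N * m)
Near-shift N {m} {z} {r} {x} (lo , hi) =
  ≤-from 0 lo (solve (N ∷ m ∷ z ∷ r ∷ x ∷ [])) ,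
  ≤-from 0 hi (solve (N ∷ m ∷ z ∷ r ∷ x ∷ []))

-- Since the intervals are half-open, touching ones (`r + r′ = d`) are still strictly ordered. The
-- centres are literals in every use, so the implicit argument is settled by evaluation.
Near-< : ∀ d {m z r x z′ r′ x′} {_ : T (z + d ≤ᵇ z′)} → r + r′ ≤ d →
  Near m z r x → Near m z′ r′ x′ → x < x′
Near-< d {m} {z} {r} {x} {z′} {r′} {x′} {le} r+r′≤d (_ , hi) (lo′ , _) =
  ≤-from 0 (+-mono-≤ (+-mono-≤ hi lo′) scaled) (solve (m ∷ z ∷ r ∷ x ∷ z′ ∷ r′ ∷ x′ ∷ []))
  where
  scaled : (z + (r + r′)) * m ≤ z′ * m
  scaled = *-monoˡ-≤ m (≤-trans (+-monoʳ-≤ z r+r′≤d) (≤ᵇ⇒≤ (z + d) z′ le))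

+-<-* : ∀ a b m {x y} → x < a * m → y < b * m → x + y < (a + b) * m
+-<-* a b m x< y< = <-≤-trans (+-mono-< x< y<) (≤-reflexive (sym (*-distribʳ-+ m a b)))

*-≤-+ : ∀ a b m {x y} → a * m ≤ x → b * m ≤ y → (a + b) * m ≤ x + y
*-≤-+ a b m ≤x ≤y = ≤-trans (≤-reflexive (*-distribʳ-+ m a b)) (+-mono-≤ ≤x ≤y)

<-shift : ∀ a b c m {u v} {_ : T (a ≤ᵇ b + c)} → u < a * m → b * m ≤ v → u < v + c * m
<-shift a b c m {u} {v} {le} u< ≤v = begin-strict
  u                <⟨ u< ⟩
  a * m            ≤⟨ *-monoˡ-≤ m (≤ᵇ⇒≤ a (b + c) le) ⟩
  (b + c) * m      ≡⟨ *-distribʳ-+ m b c ⟩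
  b * m + c * m    ≤⟨ +-monoˡ-≤ (c * m) ≤v ⟩
  v + c * m        ∎
  where open ≤-Reasoning

+-<-pad : ∀ u {L x y} → x < L → y < L → x + y < u + L + L
+-<-pad u {L} x<L y<L = <-≤-trans (+-mono-< x<L y<L) (+-monoˡ-≤ L (m≤n+m L u))

halve-≤ : ∀ {a b} → a + a ≤ b + b → a ≤ b
halve-≤ a+a≤b+b = ≮⇒≥ λ b<a → <⇒≱ (+-mono-< b<a b<a) a+a≤b+b

-- Convex triples of weights

record Convex (x y z : ℕ) (E : Set) : Set where
  constructor _,_
  field
    midpoint : y + y ≤ x + z
    equality : x + z ≤ y + y → E

convex-< : ∀ {x y z E} → y + y < x + z → Convex x y z E
convex-< 2y<x+z = <⇒≤ 2y<x+z , λ x+z≤2y → ⊥-elim (<⇒≱ 2y<x+z x+z≤2y)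

-- Both inequalities point the same way, so equality in the sum forces equality in each summand.
convex-+ : ∀ {x y z x′ y′ z′ E E′} → Convex x y z E → Convex x′ y′ z′ E′ →
  Convex (x + x′) (y + y′) (z + z′) (E × E′)
convex-+ {x} {y} {z} {x′} {y′} {z′} (le , eq) (le′ , eq′) =
  ≤-from 0 (+-mono-≤ le le′) (lemma₁ x y z x′ y′ z′) ,
  λ ge → eq (≤-from 0 (+-mono-≤ ge le′) (lemma₂ x y z x′ y′ z′)) ,
         eq′ (≤-from 0 (+-mono-≤ ge le) (lemma₃ x y z x′ y′ z′))
  where
  lemma₁ : ∀ x y z x′ y′ z′ →
    (y + y′) + (y + y′) + ((x + z) + (x′ + z′)) + 0 ≡ (x + x′) + (z + z′) + ((y + y) + (y′ + y′))
  lemma₁ = solve-∀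
  lemma₂ : ∀ x y z x′ y′ z′ →
    (x + z) + ((y + y′) + (y + y′) + (x′ + z′)) + 0 ≡ (y + y) + ((x + x′) + (z + z′) + (y′ + y′))
  lemma₂ = solve-∀
  lemma₃ : ∀ x y z x′ y′ z′ →
    (x′ + z′) + ((y + y′) + (y + y′) + (x + z)) + 0 ≡ (y′ + y′) + ((x + x′) + (z + z′) + (y + y))
  lemma₃ = solve-∀

convex-map : ∀ {x y z E E′} → (E → E′) → Convex x y z E → Convex x y z E′
convex-map f (le , eq) = le , f ∘ eq

convex-resp : ∀ {x y z x′ y′ z′ E} → x ≡ x′ → y ≡ y′ → z ≡ z′ → Convex x′ y′ z′ E → Convex x y z E
convex-resp refl refl refl c = c

private
  -- With `c = a + d`, the parallelogram identity gives 2(a² + c²) = (a + c)² + d² = 4b² + d², so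
  -- equality forces `d = 0`.
  ordered : ∀ a b c → a ≤ c → a + c ≡ b + b → Convex (a * a) (b * b) (c * c) (a ≡ c)
  ordered a b c a≤c eq with m≤n⇒∃[o]m+o≡n a≤c
  ... | d , refl = halve-≤ (≤-trans (m≤m+n _ (d * d)) (≤-reflexive (sym doubled))) , a≡a+d
    where
    B = b * b + b * b
    S = a * a + (a + d) * (a + d)
    doubled : S + S ≡ B + B + d * d
    doubled = begin
      S + S                                    ≡⟨ lemma₁ a d ⟩
      (a + (a + d)) * (a + (a + d)) + d * d    ≡⟨ cong (λ t → t * t + d * d) eq ⟩
      (b + b) * (b + b) + d * d                ≡⟨ lemma₂ b d ⟩
      B + B + d * d                            ∎
      where
      open ≡-Reasoning
      lemma₁ : ∀ a d → (a * a + (a + d) * (a + d)) + (a * a + (a + d) * (a + d))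
                     ≡ (a + (a + d)) * (a + (a + d)) + d * d
      lemma₁ = solve-∀
      lemma₂ : ∀ b d → (b + b) * (b + b) + d * d ≡ (b * b + b * b) + (b * b + b * b) + d * d
      lemma₂ = solve-∀
    d*d≡0 : S ≤ B → d * d ≡ 0
    d*d≡0 S≤B = n≤0⇒n≡0 (+-cancelˡ-≤ (B + B) (d * d) 0
      (≤-trans (≤-reflexive (sym doubled)) (≤-trans (+-mono-≤ S≤B S≤B) (m≤m+n (B + B) 0))))
    a≡a+d : S ≤ B → a ≡ a + d
    a≡a+d S≤B with m*n≡0⇒m≡0∨n≡0 d (d*d≡0 S≤B)
    ... | inj₁ refl = sym (+-identityʳ a)
    ... | inj₂ refl = sym (+-identityʳ a)

midpoint-convex : ∀ a b c → a + c ≡ b + b → Convex (a * a) (b * b) (c * c) (a ≡ c)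
midpoint-convex a b c a+c≡2b with ≤-total a c
... | inj₁ a≤c = ordered a b c a≤c a+c≡2b
... | inj₂ c≤a with ordered c b a c≤a (trans (+-comm c a) a+c≡2b)
...   | le , eq = ≤-trans le (≤-reflexive (+-comm (c * c) (a * a))) ,
                  λ ge → sym (eq (≤-trans (≤-reflexive (+-comm (c * c) (a * a))) ge))

midpoint-convex₂ : ∀ a b c a′ b′ c′ → a + c ≡ b + b → a′ + c′ ≡ b′ + b′ →
  Convex (a * a + a′ * a′) (b * b + b′ * b′) (c * c + c′ * c′) (a ≡ c × a′ ≡ c′)
midpoint-convex₂ a b c a′ b′ c′ eq eq′ = convex-+ (midpoint-convex a b c eq) (midpoint-convex a′ b′ c′ eq′)

-- The two-dimensional block

-- The slopes are dictated by the two inequalities radii-inner and radii-outer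
-- below; the truncations at 100 and 50 keep progressions within one region from
-- wrapping.
width bulge : ℕ → ℕ
width t = 100 ⊓ (20 + t)
bulge q = 50 ⊓ ((78 ∸ q) ⊓ (42 + q))

data Side : Set where
  left right : Side

centre : Side → ℕ
centre left  = 100
centre right = 300

-- Row 120 belongs to neither region. This missing row is the height gained in `climb`.
data Region (c t : ℕ) : Set where
  inner : t < 120 → Near 1 200 (width t) c → Region c t
  outer : ∀ σ → 121 ≤ t → Near 1 (centre σ) (bulge (t ∸ 121)) c → Region c t

near? : ∀ m z r x → Dec (Near m z r x)
near? m z r x = map′ (λ (l , u) → l , u) (λ (l , u) → l , u) ((z * m ≤? x + r * m) ×-dec (x <? (z + r) * m))

region? : ∀ c t → Dec (Region c t)
region? c t = map′ to from
  ((t <? 120 ×-dec near? 1 200 (width t) c) ⊎-dec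
   (121 ≤? t ×-dec (near? 1 100 (bulge (t ∸ 121)) c ⊎-dec near? 1 300 (bulge (t ∸ 121)) c)))
  where
  to : _ → Region c t
  to (inj₁ (t< , near))        = inner t< near
  to (inj₂ (≤t , inj₁ near))   = outer left ≤t near
  to (inj₂ (≤t , inj₂ near))   = outer right ≤t near
  from : Region c t → _
  from (inner t< near)       = inj₁ (t< , near)
  from (outer left ≤t near)  = inj₂ (≤t , inj₁ near)
  from (outer right ≤t near) = inj₂ (≤t , inj₂ near)

≤ᵇ-true : ∀ m n → (m ≤ᵇ n) ≡ true → m ≤ n
≤ᵇ-true m n eq = ≤ᵇ⇒≤ m n (subst T (sym eq) tt)

cell : ℕ → ℕ → ℕ
cell c t = 𝟙 (region? c t)

abstract
  -- A finite count done by evaluation: 17520 inner and 10556 outer cells make 28076 of 96000, where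
  -- 28000 are required. A quarter of the torus has only 24000.
  cells-dense : 7 * (400 * 240) ≤ 24 * ∑ 400 (λ c → ∑ 240 (cell c))
  cells-dense = ≤ᵇ-true (7 * (400 * 240)) (24 * ∑ 400 (λ c → ∑ 240 (cell c))) refl

width-≤100 : ∀ t → width t ≤ 100
width-≤100 t = m⊓n≤m 100 (20 + t)

width-≤ : ∀ t → width t ≤ 20 + t
width-≤ t = m⊓n≤n 100 (20 + t)

bulge-≤50 : ∀ q → bulge q ≤ 50
bulge-≤50 q = m⊓n≤m 50 _

bulge-≤ : ∀ q → bulge q ≤ 42 + q
bulge-≤ q = ≤-trans (m⊓n≤n 50 _) (m⊓n≤n (78 ∸ q) (42 + q))

-- Positivity of the radius keeps `78 ∸ q` out of its truncated range.
bulge-+-≤ : ∀ q → 0 < bulge q → bulge q + q ≤ 78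
bulge-+-≤ q 0<b = ≤-trans (+-monoˡ-≤ q b≤) (≤-reflexive (m∸n+n≡m (<⇒≤ q<78)))
  where
  b≤ : bulge q ≤ 78 ∸ q
  b≤ = ≤-trans (m⊓n≤n 50 _) (m⊓n≤m (78 ∸ q) (42 + q))
  q<78 : q < 78
  q<78 = ≰⇒> λ 78≤q → <⇒≱ 0<b (≤-trans b≤ (≤-reflexive (m≤n⇒m∸n≡0 78≤q)))

Near-radius>0 : ∀ z r x → Near 1 z r x → 0 < r
Near-radius>0 z zero    x (lo , hi) = ⊥-elim (<⇒≱ hi
  (≤-trans (≤-reflexive (cong (_* 1) (+-identityʳ z))) (≤-trans lo (≤-reflexive (+-identityʳ x)))))
Near-radius>0 z (suc r) x near = z<s

bulge-row-≤ : ∀ t → 121 ≤ t → bulge (t ∸ 121) + 121 ≤ 42 + t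
bulge-row-≤ t 121≤t = begin
  bulge (t ∸ 121) + 121       ≤⟨ +-monoˡ-≤ 121 (bulge-≤ (t ∸ 121)) ⟩
  42 + (t ∸ 121) + 121        ≡⟨ +-assoc 42 (t ∸ 121) 121 ⟩
  42 + (t ∸ 121 + 121)        ≡⟨ cong (42 +_) (m∸n+n≡m 121≤t) ⟩
  42 + t                      ∎
  where open ≤-Reasoning

bulge-+-row-≤ : ∀ t → 121 ≤ t → 0 < bulge (t ∸ 121) → bulge (t ∸ 121) + t ≤ 199
bulge-+-row-≤ t 121≤t 0<b = begin
  bulge (t ∸ 121) + t                    ≡⟨ cong (bulge (t ∸ 121) +_) (m∸n+n≡m 121≤t) ⟨
  bulge (t ∸ 121) + (t ∸ 121 + 121)      ≡⟨ +-assoc (bulge (t ∸ 121)) (t ∸ 121) 121 ⟨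
  bulge (t ∸ 121) + (t ∸ 121) + 121      ≤⟨ +-monoˡ-≤ 121 (bulge-+-≤ (t ∸ 121) 0<b) ⟩
  199                                    ∎
  where open ≤-Reasoning

-- The radii at the endpoints grow at most with slope 1 in the row and the radius at the midpoint
-- falls with slope 1. In the total the rows therefore cancel against t₁ + t₃ + N ≤ 2 t₂ + 1, and
-- only constants are left to compare.
radii-≤ : ∀ α α′ β N R e {t₁ t₂ t₃ w₁ w₃ b} {_ : T (α + α′ + (β + β) + 1 ≤ᵇ R + (N + e))} →
  w₁ ≤ α + t₁ → w₃ + e ≤ α′ + t₃ → b + t₂ ≤ β → t₁ + t₃ + N < suc t₂ + suc t₂ →
  (w₁ + w₃) + (b + b) ≤ R
radii-≤ α α′ β N R e {t₁} {t₂} {t₃} {w₁} {w₃} {b} {le} w₁≤ w₃≤ b≤ rows = ≤-from 0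
  (+-mono-≤ (+-mono-≤ (+-mono-≤ w₁≤ w₃≤) (+-mono-≤ b≤ b≤)) (+-mono-≤ rows (≤ᵇ⇒≤ _ (R + (N + e)) le)))
  (lemma α α′ β N R e t₁ t₂ t₃ w₁ w₃ b)
  where
  lemma : ∀ α α′ β N R e t₁ t₂ t₃ w₁ w₃ b → (w₁ + w₃) + (b + b) +
    (α + t₁ + (α′ + t₃) + (β + β) + (suc t₂ + suc t₂ + (R + (N + e)))) + 0 ≡
    R + (w₁ + (w₃ + e) + (b + t₂ + (b + t₂)) + (suc (t₁ + t₃ + N) + (α + α′ + (β + β) + 1)))
  lemma = solve-∀

-- The constants compare as 20 + 20 + 2 · 199 + 1 = 439 ≤ 440 = 200 + 240.
radii-inner : ∀ t₁ t₂ t₃ → 121 ≤ t₂ → 0 < bulge (t₂ ∸ 121) → t₁ + t₃ + 240 < suc t₂ + suc t₂ →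
  (width t₁ + width t₃) + (bulge (t₂ ∸ 121) + bulge (t₂ ∸ 121)) ≤ 200
radii-inner t₁ t₂ t₃ 121≤t₂ 0<b = radii-≤ 20 20 199 240 200 0 (width-≤ t₁)
  (≤-trans (≤-reflexive (+-identityʳ (width t₃))) (width-≤ t₃)) (bulge-+-row-≤ t₂ 121≤t₂ 0<b)

-- The constants compare as 20 + 42 + 2 · 199 + 1 = 461 = 100 + 240 + 121, with no slack.
radii-outer : ∀ t₁ t₂ t₃ → 121 ≤ t₂ → 121 ≤ t₃ → 0 < bulge (t₂ ∸ 121) → t₁ + t₃ + 240 < suc t₂ + suc t₂ →
  (width t₁ + bulge (t₃ ∸ 121)) + (bulge (t₂ ∸ 121) + bulge (t₂ ∸ 121)) ≤ 100
radii-outer t₁ t₂ t₃ 121≤t₂ 121≤t₃ 0<b =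
  radii-≤ 20 42 199 240 100 121 (width-≤ t₁) (bulge-row-≤ t₃ 121≤t₃) (bulge-+-row-≤ t₂ 121≤t₂ 0<b)

-- The map k ↦ N k + s places ℤ_m on a circle of length N m, cut into N cells of length m.
-- Progressions of the group become progressions on the circle.
cong-dilate : ∀ N s {m} a b c → Cong m (a + c) (b + b) →
  Cong (N * m) ((N * a + s) + (N * c + s)) ((N * b + s) + (N * b + s))
cong-dilate N s {m} a b c (wraps p q eq) = wraps p q (begin
  (N * a + s) + (N * c + s) + p * (N * m)   ≡⟨ lemma N s m a c p ⟩
  N * (a + c + p * m) + (s + s)             ≡⟨ cong (λ t → N * t + (s + s)) eq ⟩
  N * (b + b + q * m) + (s + s)             ≡⟨ lemma N s m b b q ⟨
  (N * b + s) + (N * b + s) + q * (N * m)   ∎)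
  where
  open ≡-Reasoning
  lemma : ∀ N s m a c p → (N * a + s) + (N * c + s) + p * (N * m) ≡ N * (a + c + p * m) + (s + s)
  lemma = solve-∀

undilate : ∀ N .{{_ : NonZero N}} s a b c →
  (N * a + s) + (N * c + s) ≡ (N * b + s) + (N * b + s) → a + c ≡ b + b
undilate N s a b c eq = *-cancelˡ-≡ (a + c) (b + b) N (+-cancelʳ-≡ (s + s) (N * (a + c)) (N * (b + b))
  (trans (sym (lemma N s a c)) (trans eq (lemma N s b b))))
  where
  lemma : ∀ N s a c → (N * a + s) + (N * c + s) ≡ N * (a + c) + (s + s)
  lemma = solve-∀

double-injective : ∀ {a b} → a + a ≡ b + b → a ≡ b
double-injective eq = ≤-antisym (halve-≤ (≤-reflexive eq)) (halve-≤ (≤-reflexive (sym eq)))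

-- The weight on one pair of cyclic groups

module Pair (m₁ m₂ m s₁ s₂ : ℕ) .{{_ : NonZero m₁}} .{{_ : NonZero m₂}}
            (m₁≤m : m₁ ≤ m) (m₂≤m : m₂ ≤ m) (s₂<240 : s₂ < 240) where

  X Y : ℕ → ℕ
  X k = 400 * k + s₁
  Y k = 240 * k + s₂

  col row : ℕ → ℕ
  col k = X k / m₁
  row k = Y k / m₂

  -- Up to the shift s₁, 200 * fold σ k is X k moved to the side around 300.
  offset : Side → ℕ
  offset left  = m₁
  offset right = 0

  fold : Side → ℕ → ℕ
  fold σ k = k + k + offset σ

  -- One row of the torus is enough for the slope to outweigh tier and all the
  -- quadratic terms.
  M tier slope : ℕ
  M     = m * m
  tier  = 4 * M + 1
  slope = suc ((tier + 20 * M + 1) / m₂)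

  -- Measured from the lower edge of the outer rows, so that the subtraction does not truncate on
  -- the outer region.
  height : ℕ → ℕ
  height k = Y k ∸ 121 * m₂

  innerWeight : ℕ → ℕ → ℕ
  innerWeight j k = j * j + k * k

  -- Half a turn is m₁/2 in `j`, which need not be an integer; the doubling in `fold` lets both
  -- halves share one integral coordinate for the quadratic term.
  outerWeight : Side → ℕ → ℕ → ℕ
  outerWeight σ j k = tier + slope * height k + (fold σ j * fold σ j + k * k)

  weight : ∀ j k → Region (col j) (row k) → ℕ
  weight j k (inner _ _)   = innerWeight j k
  weight j k (outer σ _ _) = outerWeight σ j k

  row-≤ : ∀ t k → t ≤ row k → t * m₂ ≤ Y k
  row-≤ t k t≤ = ≤-trans (*-monoˡ-≤ m₂ t≤) (m/n*n≤m (Y k) m₂)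

  row-< : ∀ t k → row k < t → Y k < t * m₂
  row-< t k <t = <-≤-trans (begin-strict
    Y k                       ≡⟨ m≡m%n+[m/n]*n (Y k) m₂ ⟩
    Y k % m₂ + row k * m₂     <⟨ +-monoˡ-< (row k * m₂) (m%n<n (Y k) m₂) ⟩
    suc (row k) * m₂          ∎) (*-monoˡ-≤ m₂ <t)
    where open ≤-Reasoning

  Y<240 : ∀ k → k < m₂ → Y k < 240 * m₂
  Y<240 k k<m₂ = begin-strict
    240 * k + s₂       <⟨ +-monoʳ-< (240 * k) s₂<240 ⟩
    240 * k + 240      ≡⟨ +-comm (240 * k) 240 ⟩
    240 + 240 * k      ≡⟨ *-suc 240 k ⟨
    240 * suc k        ≤⟨ *-monoʳ-≤ 240 k<m₂ ⟩
    240 * m₂           ∎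
    where open ≤-Reasoning

  height-+ : ∀ k → 121 ≤ row k → height k + 121 * m₂ ≡ Y k
  height-+ k 121≤ = m∸n+n≡m (row-≤ 121 k 121≤)

  slope-> : tier + 20 * M + 1 < slope * m₂
  slope-> = begin-strict
    D                       ≡⟨ m≡m%n+[m/n]*n D m₂ ⟩
    D % m₂ + D / m₂ * m₂    <⟨ +-monoˡ-< (D / m₂ * m₂) (m%n<n D m₂) ⟩
    slope * m₂              ∎
    where
    open ≤-Reasoning
    D = tier + 20 * M + 1

  sq-≤ : ∀ {k n} → k < n → n ≤ m → k * k ≤ M
  sq-≤ k<n n≤m = *-mono-≤ k≤m k≤m
    where k≤m = <⇒≤ (<-≤-trans k<n n≤m)

  inner-≤ : ∀ {j k} → j < m₁ → k < m₂ → innerWeight j k ≤ 2 * M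
  inner-≤ j< k< = ≤-trans (+-mono-≤ (sq-≤ j< m₁≤m) (sq-≤ k< m₂≤m)) (≤-reflexive (lemma M))
    where
    lemma : ∀ M → M + M ≡ 2 * M
    lemma = solve-∀

  fold-≤ : ∀ σ {j} → j < m₁ → fold σ j ≤ 3 * m
  fold-≤ σ {j} j<m₁ = ≤-trans (+-mono-≤ (+-mono-≤ j≤m j≤m) (offset-≤ σ)) (≤-reflexive (lemma m))
    where
    j≤m = <⇒≤ (<-≤-trans j<m₁ m₁≤m)
    offset-≤ : ∀ σ → offset σ ≤ m
    offset-≤ left  = m₁≤m
    offset-≤ right = z≤n
    lemma : ∀ m → m + m + m ≡ 3 * m
    lemma = solve-∀

  outer-≤ : ∀ σ {j k} → j < m₁ → k < m₂ → fold σ j * fold σ j + k * k ≤ 10 * M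
  outer-≤ σ j< k< = ≤-trans (+-mono-≤ (*-mono-≤ (fold-≤ σ j<) (fold-≤ σ j<)) (sq-≤ k< m₂≤m)) (≤-reflexive (lemma m))
    where
    lemma : ∀ m → 3 * m * (3 * m) + m * m ≡ 10 * (m * m)
    lemma = solve-∀

  -- The division by `m₂` in `slope` keeps the rise of the weight at O(M): heights are at most 119
  -- m₂ and slope · m₂ ≤ M + (24 M + 2). The total is at most 2989 M + 239, and M ≥ 1.
  weight-≤ : ∀ {j k} → j < m₁ → k < m₂ → (r : Region (col j) (row k)) → weight j k r ≤ 4000 * M
  weight-≤ j< k< (inner _ _) = ≤-trans (inner-≤ j< k<) (*-monoˡ-≤ M {2} {4000} (≤ᵇ⇒≤ 2 4000 _))
  weight-≤ {j} {k} j< k< (outer σ 121≤ _) = bound M (slope * height k) _ 1≤M rise (outer-≤ σ j< k<)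
    where
    open ≤-Reasoning
    1≤m : 1 ≤ m
    1≤m = ≤-trans (>-nonZero⁻¹ m₂) m₂≤m
    1≤M : 1 ≤ M
    1≤M = *-mono-≤ 1≤m 1≤m
    m₂≤M : m₂ ≤ M
    m₂≤M = ≤-trans m₂≤m (≤-trans (≤-reflexive (sym (*-identityʳ m))) (*-monoʳ-≤ m 1≤m))
    D = tier + 20 * M + 1
    height-≤ : height k ≤ 119 * m₂
    height-≤ = +-cancelʳ-≤ (121 * m₂) _ _ (begin
      height k + 121 * m₂      ≡⟨ height-+ k 121≤ ⟩
      Y k                      ≤⟨ <⇒≤ (Y<240 k k<) ⟩
      240 * m₂                 ≡⟨ *-distribʳ-+ m₂ 119 121 ⟩
      119 * m₂ + 121 * m₂      ∎)
    rise : slope * height k ≤ 119 * (M + (tier + 20 * M + 1))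
    rise = begin
      slope * height k          ≤⟨ *-monoʳ-≤ slope height-≤ ⟩
      slope * (119 * m₂)        ≡⟨ lemma slope m₂ ⟩
      119 * (slope * m₂)        ≤⟨ *-monoʳ-≤ 119 (+-mono-≤ m₂≤M (m/n*n≤m D m₂)) ⟩
      119 * (M + D)             ∎
      where
      lemma : ∀ a b → a * (119 * b) ≡ 119 * (a * b)
      lemma = solve-∀
    bound : ∀ M h q → 1 ≤ M → h ≤ 119 * (M + (4 * M + 1 + 20 * M + 1)) → q ≤ 10 * M →
      4 * M + 1 + h + q ≤ 4000 * M
    bound M h q 1≤M h≤ q≤ = ≤-from (11 * M + 761) (+-mono-≤ (+-mono-≤ h≤ q≤) (*-monoʳ-≤ 1000 1≤M)) (lemma M h q)
      where
      lemma : ∀ M h q → 4 * M + 1 + h + q + (119 * (M + (4 * M + 1 + 20 * M + 1)) + 10 * M + 1000 * M) + (11 * M + 761)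
         ≡ 4000 * M + (h + q + 1000 * 1)
      lemma = solve-∀

  col-near : ∀ {z r} j → Near 1 z r (col j) → Near m₁ z r (X j)
  col-near {z} {r} j = Near-/ m₁ z r (X j)

  CongX CongY : ℕ → ℕ → ℕ → Set
  CongX j₁ j₂ j₃ = Cong (400 * m₁) (X j₁ + X j₃) (X j₂ + X j₂)
  CongY k₁ k₂ k₃ = Cong (240 * m₂) (Y k₁ + Y k₃) (Y k₂ + Y k₂)

  -- Rows are floors, so the wrapped equation survives for them only up to rounding: the doubled
  -- midpoint may lose almost two rows.
  rows-wrap : ∀ k₁ k₂ k₃ → Y k₁ + Y k₃ + 240 * m₂ ≡ Y k₂ + Y k₂ →
    row k₁ + row k₃ + 240 < suc (row k₂) + suc (row k₂)
  rows-wrap k₁ k₂ k₃ eq = *-cancelʳ-< m₂ _ _ (begin-strict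
    (row k₁ + row k₃ + 240) * m₂               ≡⟨ *-distribʳ-+ m₂ (row k₁ + row k₃) 240 ⟩
    (row k₁ + row k₃) * m₂ + 240 * m₂          ≤⟨ +-monoˡ-≤ (240 * m₂) (*-≤-+ (row k₁) (row k₃) m₂ (row-≤ (row k₁) k₁ ≤-refl) (row-≤ (row k₃) k₃ ≤-refl)) ⟩
    Y k₁ + Y k₃ + 240 * m₂                     ≡⟨ eq ⟩
    Y k₂ + Y k₂                                <⟨ +-<-* (suc (row k₂)) (suc (row k₂)) m₂ (row-< (suc (row k₂)) k₂ ≤-refl) (row-< (suc (row k₂)) k₂ ≤-refl) ⟩
    (suc (row k₂) + suc (row k₂)) * m₂         ∎)
    where open ≤-Reasoning

  -- Both column sums lie within half a turn of 400 and both row sums are below a full turn, so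
  -- nothing wraps and the progression is a genuine one in ℕ².
  inner-inner-inner : ∀ {j₁ j₂ j₃ k₁ k₂ k₃} → CongX j₁ j₂ j₃ → CongY k₁ k₂ k₃ →
    row k₁ < 120 → row k₂ < 120 → row k₃ < 120 →
    Near 1 200 (width (row k₁)) (col j₁) → Near 1 200 (width (row k₂)) (col j₂) →
      Near 1 200 (width (row k₃)) (col j₃) →
    Convex (innerWeight j₁ k₁) (innerWeight j₂ k₂) (innerWeight j₃ k₃) (j₁ ≡ j₃ × k₁ ≡ k₃)
  inner-inner-inner {j₁} {j₂} {j₃} {k₁} {k₂} {k₃} congX congY t₁< t₂< t₃< n₁ n₂ n₃ =
    midpoint-convex₂ j₁ j₂ j₃ k₁ k₂ k₃ (undilate 400 s₁ j₁ j₂ j₃ X≡) (undilate 240 s₂ k₁ k₂ k₃ Y≡)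
    where
    w₁ = width (row k₁)
    w₂ = width (row k₂)
    w₃ = width (row k₃)
    u : Near m₁ 400 (w₁ + w₃) (X j₁ + X j₃)
    u = Near-+ {z = 200} {z′ = 200} (col-near j₁ n₁) (col-near j₃ n₃)
    v : Near m₁ 400 (w₂ + w₂) (X j₂ + X j₂)
    v = Near-+ {z = 200} {z′ = 200} (col-near j₂ n₂) (col-near j₂ n₂)
    radii : ∀ a b c d → (width a + width b) + (width c + width d) ≤ 400
    radii a b c d = +-mono-≤ (+-mono-≤ (width-≤100 a) (width-≤100 b)) (+-mono-≤ (width-≤100 c) (width-≤100 d))
    X≡ : X j₁ + X j₃ ≡ X j₂ + X j₂
    X≡ = cong-≡ congX
      (Near-< 400 {z = 400} {z′ = 800} (radii (row k₁) (row k₃) (row k₂) (row k₂)) u (Near-shift 400 v))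
      (Near-< 400 {z = 400} {z′ = 800} (radii (row k₂) (row k₂) (row k₁) (row k₃)) v (Near-shift 400 u))
    below : ∀ a b → row a < 120 → row b < 120 → Y a + Y b < 240 * m₂
    below a b a< b< = +-<-* 120 120 m₂ (row-< 120 a a<) (row-< 120 b b<)
    Y≡ : Y k₁ + Y k₃ ≡ Y k₂ + Y k₂
    Y≡ = cong-≡ congY
      (<-≤-trans (below k₁ k₃ t₁< t₃<) (m≤n+m (240 * m₂) (Y k₂ + Y k₂)))
      (<-≤-trans (below k₂ k₂ t₂< t₂<) (m≤n+m (240 * m₂) (Y k₁ + Y k₃)))

  -- The row sums lie below 240 and from 242 on, so the rows must wrap once. Then `radii-inner`
  -- applies, while the column sums are centred at 400 and at 200 or 600, half a turn apart: they
  -- cannot meet.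
  inner-outer-inner : ∀ {j₁ j₂ j₃ k₁ k₂ k₃} σ → CongX j₁ j₂ j₃ → CongY k₁ k₂ k₃ → k₂ < m₂ →
    row k₁ < 120 → 121 ≤ row k₂ → row k₃ < 120 →
    Near 1 200 (width (row k₁)) (col j₁) → Near 1 (centre σ) (bulge (row k₂ ∸ 121)) (col j₂) →
    Near 1 200 (width (row k₃)) (col j₃) → ⊥
  inner-outer-inner {j₁} {j₂} {j₃} {k₁} {k₂} {k₃} σ congX congY k₂<m₂ t₁< ≤t₂ t₃< n₁ n₂ n₃ = horizontal σ n₂
    where
    w₁ = width (row k₁)
    w₃ = width (row k₃)
    b = bulge (row k₂ ∸ 121)
    below : Y k₁ + Y k₃ < 240 * m₂
    below = +-<-* 120 120 m₂ (row-< 120 k₁ t₁<) (row-< 120 k₃ t₃<)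
    above : 242 * m₂ ≤ Y k₂ + Y k₂
    above = *-≤-+ 121 121 m₂ (row-≤ 121 k₂ ≤t₂) (row-≤ 121 k₂ ≤t₂)
    Y< : Y k₁ + Y k₃ < Y k₂ + Y k₂
    Y< = <-≤-trans below (≤-trans (*-monoˡ-≤ m₂ {240} {242} (≤ᵇ⇒≤ 240 242 _)) above)
    wrap : Y k₁ + Y k₃ + 240 * m₂ ≡ Y k₂ + Y k₂
    wrap = [ (λ eq → ⊥-elim (<-irrefl eq Y<)) , (λ eq → eq) ]′ (cong-≡⊎ congY
      (<-≤-trans Y< (m≤m+n (Y k₂ + Y k₂) (240 * m₂)))
      (+-<-pad (Y k₁ + Y k₃) (Y<240 k₂ k₂<m₂) (Y<240 k₂ k₂<m₂)))
    radii : (w₁ + w₃) + (b + b) ≤ 200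
    radii = radii-inner (row k₁) (row k₂) (row k₃) ≤t₂ (Near-radius>0 (centre σ) b (col j₂) n₂) (rows-wrap k₁ k₂ k₃ wrap)
    radii′ : (b + b) + (w₁ + w₃) ≤ 200
    radii′ = ≤-trans (≤-reflexive (+-comm (b + b) (w₁ + w₃))) radii
    u : Near m₁ 400 (w₁ + w₃) (X j₁ + X j₃)
    u = Near-+ {z = 200} {z′ = 200} (col-near j₁ n₁) (col-near j₃ n₃)
    horizontal : ∀ σ → Near 1 (centre σ) b (col j₂) → ⊥
    horizontal left n = cong-gap (cong-sym congX)
      (Near-< 200 {z = 200} {z′ = 400} radii′ v u) (Near-< 200 {z = 400} {z′ = 600} radii u (Near-shift 400 v))
      where
      v : Near m₁ 200 (b + b) (X j₂ + X j₂)
      v = Near-+ {z = 100} {z′ = 100} (col-near j₂ n) (col-near j₂ n)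
    horizontal right n = cong-gap congX
      (Near-< 200 {z = 400} {z′ = 600} radii u v) (Near-< 200 {z = 600} {z′ = 800} radii′ v (Near-shift 400 u))
      where
      v : Near m₁ 600 (b + b) (X j₂ + X j₂)
      v = Near-+ {z = 300} {z′ = 300} (col-near j₂ n) (col-near j₂ n)

  -- If the rows do not wrap, the outer endpoint is so high that its weight alone exceeds twice that
  -- of the midpoint. If they wrap, the column sums are centred at 300 or 500 and at 200 or 600,
  -- always a quarter turn apart modulo 400, and `radii-outer` keeps them disjoint.
  inner-outer-outer : ∀ {j₁ j₂ j₃ k₁ k₂ k₃} σ τ → CongX j₁ j₂ j₃ → CongY k₁ k₂ k₃ → j₂ < m₁ → k₂ < m₂ →
    k₃ < m₂ →
    row k₁ < 120 → 121 ≤ row k₂ → 121 ≤ row k₃ →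
    Near 1 200 (width (row k₁)) (col j₁) → Near 1 (centre σ) (bulge (row k₂ ∸ 121)) (col j₂) →
    Near 1 (centre τ) (bulge (row k₃ ∸ 121)) (col j₃) →
    outerWeight σ j₂ k₂ + outerWeight σ j₂ k₂
    < innerWeight j₁ k₁ + outerWeight τ j₃ k₃
  inner-outer-outer {j₁} {j₂} {j₃} {k₁} {k₂} {k₃} σ τ congX congY j₂<m₁ k₂<m₂ k₃<m₂ t₁< ≤t₂ ≤t₃ n₁ n₂ n₃
    = [ unwrapped , (λ eq → ⊥-elim (wrapped eq)) ]′ (cong-≡⊎ congY
      (<-shift 360 242 240 m₂ (+-<-* 120 240 m₂ (row-< 120 k₁ t₁<) (Y<240 k₃ k₃<m₂)) above)
      (+-<-pad (Y k₁ + Y k₃) (Y<240 k₂ k₂<m₂) (Y<240 k₂ k₂<m₂)))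
    where
    above : 242 * m₂ ≤ Y k₂ + Y k₂
    above = *-≤-+ 121 121 m₂ (row-≤ 121 k₂ ≤t₂) (row-≤ 121 k₂ ≤t₂)
    unwrapped : Y k₁ + Y k₃ ≡ Y k₂ + Y k₂ →
      outerWeight σ j₂ k₂ + outerWeight σ j₂ k₂
      < innerWeight j₁ k₁ + outerWeight τ j₃ k₃
    -- The rise over one row pays for the second `tier` and for both quadratic terms of the
    -- midpoint.
    unwrapped eq = steep M (slope * height k₂) (slope * height k₃) (slope * m₂)
      (j₁ * j₁ + k₁ * k₁) (fold σ j₂ * fold σ j₂ + k₂ * k₂) (fold τ j₃ * fold τ j₃ + k₃ * k₃) slope-> rise (outer-≤ σ j₂<m₁ k₂<m₂)
      where
      open ≤-Reasoning
      -- The inner endpoint lies below row 120 while heights start at row 121; this difference is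
      -- the extra `m₂`.
      climb : height k₂ + height k₂ + m₂ ≤ height k₃
      climb = ≤-from 0
        (+-mono-≤ (+-mono-≤ (<⇒≤ (row-< 120 k₁ t₁<)) (≤-reflexive (sym eq)))
          (+-mono-≤ (≤-reflexive (sym (height-+ k₃ ≤t₃))) (+-mono-≤ h₂≤ h₂≤)))
        (lemma (height k₂) (height k₃) m₂ (Y k₁) (Y k₂) (Y k₃))
        where
        h₂≤ : height k₂ + 121 * m₂ ≤ Y k₂
        h₂≤ = ≤-reflexive (height-+ k₂ ≤t₂)
        lemma : ∀ h₂ h₃ m y₁ y₂ y₃ →
          h₂ + h₂ + m + (120 * m + (y₁ + y₃) + (h₃ + 121 * m + (y₂ + y₂))) + 0 ≡
          h₃ + (y₁ + (y₂ + y₂) + (y₃ + (h₂ + 121 * m + (h₂ + 121 * m))))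
        lemma = solve-∀
      rise : slope * height k₂ + slope * height k₂ + slope * m₂ ≤ slope * height k₃
      rise = begin
        slope * height k₂ + slope * height k₂ + slope * m₂   ≡⟨ lemma slope (height k₂) m₂ ⟩
        slope * (height k₂ + height k₂ + m₂)                 ≤⟨ *-monoʳ-≤ slope climb ⟩
        slope * height k₃                                    ∎
        where
        lemma : ∀ s h m → s * h + s * h + s * m ≡ s * (h + h + m)
        lemma = solve-∀
      steep : ∀ M h₂ h₃ d q₁ q₂ q₃ → 4 * M + 1 + 20 * M + 1 < d → h₂ + h₂ + d ≤ h₃ → q₂ ≤ 10 * M →
        (4 * M + 1 + h₂ + q₂) + (4 * M + 1 + h₂ + q₂) < q₁ + (4 * M + 1 + h₃ + q₃)
      steep M h₂ h₃ d q₁ q₂ q₃ <d ≤h₃ q₂≤ = ≤-from (q₁ + q₃ + 1) (+-mono-≤ (+-mono-≤ <d ≤h₃) (+-mono-≤ q₂≤ q₂≤)) (lemma M h₂ h₃ d q₁ q₂ q₃)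
        where
        lemma : ∀ M h₂ h₃ d q₁ q₂ q₃ →
          suc ((4 * M + 1 + h₂ + q₂) + (4 * M + 1 + h₂ + q₂)) + (d + h₃ + (10 * M + 10 * M)) + (q₁ + q₃ + 1) ≡
          q₁ + (4 * M + 1 + h₃ + q₃) + (suc (4 * M + 1 + 20 * M + 1) + (h₂ + h₂ + d) + (q₂ + q₂))
        lemma = solve-∀
    wrapped : Y k₁ + Y k₃ + 240 * m₂ ≡ Y k₂ + Y k₂ → ⊥
    wrapped eq = horizontal σ τ n₂ n₃
      where
      w = width (row k₁)
      b₂ = bulge (row k₂ ∸ 121)
      b₃ = bulge (row k₃ ∸ 121)
      radii : (w + b₃) + (b₂ + b₂) ≤ 100
      radii = radii-outer (row k₁) (row k₂) (row k₃) ≤t₂ ≤t₃ (Near-radius>0 (centre σ) b₂ (col j₂) n₂) (rows-wrap k₁ k₂ k₃ eq)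
      radii′ : (b₂ + b₂) + (w + b₃) ≤ 100
      radii′ = ≤-trans (≤-reflexive (+-comm (b₂ + b₂) (w + b₃))) radii
      horizontal : ∀ σ τ → Near 1 (centre σ) b₂ (col j₂) → Near 1 (centre τ) b₃ (col j₃) → ⊥
      horizontal σ τ n₂ n₃ = contradict σ τ
        (Near-+ {z = centre σ} {z′ = centre σ} (col-near j₂ n₂) (col-near j₂ n₂))
        (Near-+ {z = 200} {z′ = centre τ} (col-near j₁ n₁) (col-near j₃ n₃))
        where
        contradict : ∀ σ τ → Near m₁ (centre σ + centre σ) (b₂ + b₂) (X j₂ + X j₂) →
          Near m₁ (200 + centre τ) (w + b₃) (X j₁ + X j₃) → ⊥
        contradict left left v u = cong-gap (cong-sym congX)
          (Near-< 100 {z = 200} {z′ = 300} radii′ v u) (Near-< 100 {z = 300} {z′ = 600} radii u (Near-shift 400 v))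
        contradict left right v u = cong-gap (cong-sym congX)
          (Near-< 100 {z = 200} {z′ = 500} radii′ v u) (Near-< 100 {z = 500} {z′ = 600} radii u (Near-shift 400 v))
        contradict right left v u = cong-gap congX
          (Near-< 100 {z = 300} {z′ = 600} radii u v) (Near-< 100 {z = 600} {z′ = 700} radii′ v (Near-shift 400 u))
        contradict right right v u = cong-gap congX
          (Near-< 100 {z = 500} {z′ = 600} radii u v) (Near-< 100 {z = 600} {z′ = 900} radii′ v (Near-shift 400 u))

  -- Outer progressions, with the two halves identified

  ξ : Side → ℕ → ℕ
  ξ σ k = 200 * fold σ k + s₁

  ξ-near : ∀ σ {r} j → Near 1 (centre σ) r (col j) → Near m₁ 300 r (ξ σ j)
  ξ-near left {r} j n = subst (Near m₁ 300 r) (lemma j m₁ s₁) (Near-shift 200 (col-near j n))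
    where
    lemma : ∀ j m s → 400 * j + s + 200 * m ≡ 200 * (j + j + m) + s
    lemma = solve-∀
  ξ-near right {r} j n = subst (Near m₁ 300 r) (lemma j s₁) (col-near j n)
    where
    lemma : ∀ j s → 400 * j + s ≡ 200 * (j + j + 0) + s
    lemma = solve-∀

  -- Moving two endpoints on the same side by half a turn each changes their sum by a full turn, and
  -- likewise for the doubled midpoint. The side of the midpoint is therefore independent of that of
  -- the endpoints.
  ξ-cong : ∀ σ τ j₁ j₂ j₃ → CongX j₁ j₂ j₃ → Cong (400 * m₁) (ξ σ j₁ + ξ σ j₃) (ξ τ j₂ + ξ τ j₂)
  ξ-cong σ τ j₁ j₂ j₃ congX = cong-sym (lift τ j₂ j₂ (cong-sym (lift σ j₁ j₃ congX)))
    where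
    lift : ∀ σ a c {v} → Cong (400 * m₁) (X a + X c) v → Cong (400 * m₁) (ξ σ a + ξ σ c) v
    lift left a c {v} u≈v = subst (λ u → Cong (400 * m₁) u v) (lemma a c m₁ s₁) (cong-shift u≈v)
      where
      lemma : ∀ a c m s → 400 * a + s + (400 * c + s) + 400 * m ≡
        200 * (a + a + m) + s + (200 * (c + c + m) + s)
      lemma = solve-∀
    lift right a c {v} u≈v = subst (λ u → Cong (400 * m₁) u v) (lemma a c s₁) u≈v
      where
      lemma : ∀ a c s → 400 * a + s + (400 * c + s) ≡ 200 * (a + a + 0) + s + (200 * (c + c + 0) + s)
      lemma = solve-∀

  fold-injective : ∀ σ {a c} → fold σ a ≡ fold σ c → a ≡ c
  fold-injective σ eq = double-injective (+-cancelʳ-≡ (offset σ) _ _ eq)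

  -- Row sums lie between 242 and 480, less than a turn apart, so rows do not wrap. Endpoints on
  -- opposite sides have column sum near 400, half a turn from the doubled midpoint, which is
  -- impossible. Endpoints on one side are compared with the midpoint after folding.
  outer-outer-outer : ∀ {j₁ j₂ j₃ k₁ k₂ k₃} ρ σ τ → CongX j₁ j₂ j₃ → CongY k₁ k₂ k₃ → k₁ < m₂ → k₂ < m₂ →
    k₃ < m₂ →
    121 ≤ row k₁ → 121 ≤ row k₂ → 121 ≤ row k₃ →
    Near 1 (centre ρ) (bulge (row k₁ ∸ 121)) (col j₁) → Near 1 (centre σ) (bulge (row k₂ ∸ 121)) (col j₂) →
    Near 1 (centre τ) (bulge (row k₃ ∸ 121)) (col j₃) →
    Convex (outerWeight ρ j₁ k₁) (outerWeight σ j₂ k₂) (outerWeight τ j₃ k₃) (j₁ ≡ j₃ × k₁ ≡ k₃)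
  outer-outer-outer {j₁} {j₂} {j₃} {k₁} {k₂} {k₃} ρ σ τ congX congY k₁< k₂< k₃< ≤t₁ ≤t₂ ≤t₃ n₁ n₂ n₃ =
    by-sides ρ σ τ n₁ n₂ n₃
    where
    b₁ = bulge (row k₁ ∸ 121)
    b₂ = bulge (row k₂ ∸ 121)
    b₃ = bulge (row k₃ ∸ 121)
    radii : ∀ a b c d → (bulge a + bulge b) + (bulge c + bulge d) ≤ 200
    radii a b c d = +-mono-≤ (+-mono-≤ (bulge-≤50 a) (bulge-≤50 b)) (+-mono-≤ (bulge-≤50 c) (bulge-≤50 d))
    radii₁ : (b₁ + b₃) + (b₂ + b₂) ≤ 200
    radii₁ = radii (row k₁ ∸ 121) (row k₃ ∸ 121) (row k₂ ∸ 121) (row k₂ ∸ 121)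
    radii₂ : (b₂ + b₂) + (b₁ + b₃) ≤ 200
    radii₂ = radii (row k₂ ∸ 121) (row k₂ ∸ 121) (row k₁ ∸ 121) (row k₃ ∸ 121)
    Y≡ : Y k₁ + Y k₃ ≡ Y k₂ + Y k₂
    Y≡ = cong-≡ congY
      (<-shift 480 242 240 m₂ (+-<-* 240 240 m₂ (Y<240 k₁ k₁<) (Y<240 k₃ k₃<))
        (*-≤-+ 121 121 m₂ (row-≤ 121 k₂ ≤t₂) (row-≤ 121 k₂ ≤t₂)))
      (<-shift 480 242 240 m₂ (+-<-* 240 240 m₂ (Y<240 k₂ k₂<) (Y<240 k₂ k₂<))
        (*-≤-+ 121 121 m₂ (row-≤ 121 k₁ ≤t₁) (row-≤ 121 k₃ ≤t₃)))
    height≡ : height k₁ + height k₃ ≡ height k₂ + height k₂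
    height≡ = +-cancelʳ-≡ (121 * m₂ + 121 * m₂) _ _ (begin
      height k₁ + height k₃ + (121 * m₂ + 121 * m₂)       ≡⟨ lemma (height k₁) (height k₃) (121 * m₂) ⟩
      height k₁ + 121 * m₂ + (height k₃ + 121 * m₂)       ≡⟨ cong₂ _+_ (height-+ k₁ ≤t₁) (height-+ k₃ ≤t₃) ⟩
      Y k₁ + Y k₃                                         ≡⟨ Y≡ ⟩
      Y k₂ + Y k₂                                         ≡⟨ cong₂ _+_ (height-+ k₂ ≤t₂) (height-+ k₂ ≤t₂) ⟨
      height k₂ + 121 * m₂ + (height k₂ + 121 * m₂)       ≡⟨ lemma (height k₂) (height k₂) (121 * m₂) ⟨
      height k₂ + height k₂ + (121 * m₂ + 121 * m₂)       ∎)
      where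
      open ≡-Reasoning
      lemma : ∀ a b c → a + b + (c + c) ≡ a + c + (b + c)
      lemma = solve-∀
    same-side : ∀ ρ σ → Near 1 (centre ρ) b₁ (col j₁) → Near 1 (centre σ) b₂ (col j₂) →
      Near 1 (centre ρ) b₃ (col j₃) →
      Convex (outerWeight ρ j₁ k₁) (outerWeight σ j₂ k₂) (outerWeight ρ j₃ k₃) (j₁ ≡ j₃ × k₁ ≡ k₃)
    -- The heights form a progression in ℕ, so `tier` and the linear term cancel and only the
    -- quadratic part decides.
    same-side ρ σ n₁ n₂ n₃ = raise tier slope height≡
      (midpoint-convex₂ (fold ρ j₁) (fold σ j₂) (fold ρ j₃) k₁ k₂ k₃
          (undilate 200 s₁ (fold ρ j₁) (fold σ j₂) (fold ρ j₃) ξ≡) (undilate 240 s₂ k₁ k₂ k₃ Y≡))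
      where
      u : Near m₁ 600 (b₁ + b₃) (ξ ρ j₁ + ξ ρ j₃)
      u = Near-+ (ξ-near ρ j₁ n₁) (ξ-near ρ j₃ n₃)
      v : Near m₁ 600 (b₂ + b₂) (ξ σ j₂ + ξ σ j₂)
      v = Near-+ (ξ-near σ j₂ n₂) (ξ-near σ j₂ n₂)
      ξ≡ : ξ ρ j₁ + ξ ρ j₃ ≡ ξ σ j₂ + ξ σ j₂
      ξ≡ = cong-≡ (ξ-cong ρ σ j₁ j₂ j₃ congX)
        (Near-< 200 {z = 600} {z′ = 1000} radii₁ u (Near-shift 400 v))
        (Near-< 200 {z = 600} {z′ = 1000} radii₂ v (Near-shift 400 u))
      raise : ∀ t s {h₁ h₂ h₃ q₁ q₂ q₃} → h₁ + h₃ ≡ h₂ + h₂ →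
        Convex q₁ q₂ q₃ (fold ρ j₁ ≡ fold ρ j₃ × k₁ ≡ k₃) →
        Convex (t + s * h₁ + q₁) (t + s * h₂ + q₂) (t + s * h₃ + q₃) (j₁ ≡ j₃ × k₁ ≡ k₃)
      raise t s {h₁} {h₂} {h₃} {q₁} {q₂} {q₃} h≡ (le , eq) =
        ≤-from 0 (+-mono-≤ le s*h≤) (lemma₁ t (s * h₁) (s * h₂) (s * h₃) q₁ q₂ q₃) ,
        λ ge → let j≡ , k≡ = eq (≤-from 0 (+-mono-≤ ge s*h≤) (lemma₂ t (s * h₁) (s * h₂) (s * h₃) q₁ q₂ q₃))
               in fold-injective ρ j≡ , k≡
        where
        s*h≡ : s * h₁ + s * h₃ ≡ s * h₂ + s * h₂
        s*h≡ = trans (sym (*-distribˡ-+ s h₁ h₃)) (trans (cong (s *_) h≡) (*-distribˡ-+ s h₂ h₂))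
        s*h≤ : s * h₂ + s * h₂ ≤ s * h₁ + s * h₃
        s*h≤ = ≤-reflexive (sym s*h≡)
        lemma₁ : ∀ t a b c q₁ q₂ q₃ → (t + b + q₂) + (t + b + q₂) + ((q₁ + q₃) + (a + c)) + 0 ≡
          (t + a + q₁) + (t + c + q₃) + ((q₂ + q₂) + (b + b))
        lemma₁ = solve-∀
        lemma₂ : ∀ t a b c q₁ q₂ q₃ → (q₁ + q₃) + ((t + b + q₂) + (t + b + q₂) + (a + c)) + 0 ≡
          (q₂ + q₂) + ((t + a + q₁) + (t + c + q₃) + (b + b))
        lemma₂ = solve-∀
    opposite : ∀ σ → Near m₁ 400 (b₁ + b₃) (X j₁ + X j₃) → Near 1 (centre σ) b₂ (col j₂) → ⊥
    opposite left u n = cong-gap (cong-sym congX)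
      (Near-< 200 {z = 200} {z′ = 400} radii₂ v u) (Near-< 200 {z = 400} {z′ = 600} radii₁ u (Near-shift 400 v))
      where
      v : Near m₁ 200 (b₂ + b₂) (X j₂ + X j₂)
      v = Near-+ (col-near j₂ n) (col-near j₂ n)
    opposite right u n = cong-gap congX
      (Near-< 200 {z = 400} {z′ = 600} radii₁ u v) (Near-< 200 {z = 600} {z′ = 800} radii₂ v (Near-shift 400 u))
      where
      v : Near m₁ 600 (b₂ + b₂) (X j₂ + X j₂)
      v = Near-+ (col-near j₂ n) (col-near j₂ n)
    by-sides : ∀ ρ σ τ → Near 1 (centre ρ) b₁ (col j₁) → Near 1 (centre σ) b₂ (col j₂) →
      Near 1 (centre τ) b₃ (col j₃) →
      Convex (outerWeight ρ j₁ k₁) (outerWeight σ j₂ k₂) (outerWeight τ j₃ k₃) (j₁ ≡ j₃ × k₁ ≡ k₃)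
    by-sides left  σ left  n₁ n₂ n₃ = same-side left σ n₁ n₂ n₃
    by-sides right σ right n₁ n₂ n₃ = same-side right σ n₁ n₂ n₃
    by-sides left  σ right n₁ n₂ n₃ = ⊥-elim (opposite σ (Near-+ (col-near j₁ n₁) (col-near j₃ n₃)) n₂)
    by-sides right σ left  n₁ n₂ n₃ = ⊥-elim (opposite σ (Near-+ (col-near j₁ n₁) (col-near j₃ n₃)) n₂)

  -- For an inner midpoint with an outer endpoint: `tier` exceeds twice the largest inner weight,
  -- wherever the points lie.
  tier-< : ∀ {q} h {r} → q ≤ 2 * M → q + q < tier + h + r
  tier-< {q} h {r} q≤ = ≤-from (h + r) (+-mono-≤ q≤ q≤) (lemma M q h r)
    where
    lemma : ∀ M q h r → suc (q + q) + (2 * M + 2 * M) + (h + r) ≡ 4 * M + 1 + h + r + (q + q)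
    lemma = solve-∀

  convex-<-swap : ∀ {x y z E} → y + y < z + x → Convex x y z E
  convex-<-swap {x} {y} {z} lt = convex-< (<-≤-trans lt (≤-reflexive (+-comm z x)))

  cong-swap : ∀ {M u w v} → Cong M (u + w) v → Cong M (w + u) v
  cong-swap {M} {u} {w} {v} = subst (λ t → Cong M t v) (+-comm u w)

  weight-convex : ∀ {j₁ j₂ j₃ k₁ k₂ k₃} → j₁ < m₁ → j₂ < m₁ → j₃ < m₁ → k₁ < m₂ → k₂ < m₂ → k₃ < m₂ →
    Cong m₁ (j₁ + j₃) (j₂ + j₂) → Cong m₂ (k₁ + k₃) (k₂ + k₂) →
    (r₁ : Region (col j₁) (row k₁)) (r₂ : Region (col j₂) (row k₂)) (r₃ : Region (col j₃) (row k₃)) →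
    Convex (weight j₁ k₁ r₁) (weight j₂ k₂ r₂) (weight j₃ k₃ r₃) (j₁ ≡ j₃ × k₁ ≡ k₃)
  weight-convex {j₁} {j₂} {j₃} {k₁} {k₂} {k₃} j₁< j₂< j₃< k₁< k₂< k₃< congJ congK = regions
    where
    congX : CongX j₁ j₂ j₃
    congX = cong-dilate 400 s₁ j₁ j₂ j₃ congJ
    congY : CongY k₁ k₂ k₃
    congY = cong-dilate 240 s₂ k₁ k₂ k₃ congK
    regions : (r₁ : Region (col j₁) (row k₁)) (r₂ : Region (col j₂) (row k₂)) (r₃ : Region (col j₃) (row k₃)) →
      Convex (weight j₁ k₁ r₁) (weight j₂ k₂ r₂) (weight j₃ k₃ r₃) (j₁ ≡ j₃ × k₁ ≡ k₃)
    regions (inner t₁ n₁) (inner t₂ n₂) (inner t₃ n₃) = inner-inner-inner {j₁} {j₂} {j₃} {k₁} {k₂} {k₃} congX congY t₁ t₂ t₃ n₁ n₂ n₃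
    regions (inner t₁ n₁) (inner t₂ n₂) (outer τ t₃ n₃) = convex-<
      (<-≤-trans (tier-< (slope * height k₃) (inner-≤ j₂< k₂<)) (m≤n+m _ (j₁ * j₁ + k₁ * k₁)))
    regions (outer ρ t₁ n₁) (inner t₂ n₂) r₃ = convex-<
      (<-≤-trans (tier-< (slope * height k₁) (inner-≤ j₂< k₂<)) (m≤m+n _ (weight j₃ k₃ r₃)))
    regions (inner t₁ n₁) (outer σ t₂ n₂) (inner t₃ n₃) =
      ⊥-elim (inner-outer-inner {j₁} {j₂} {j₃} {k₁} {k₂} {k₃} σ congX congY k₂< t₁ t₂ t₃ n₁ n₂ n₃)
    regions (inner t₁ n₁) (outer σ t₂ n₂) (outer τ t₃ n₃) = convex-<
      (inner-outer-outer {j₁} {j₂} {j₃} {k₁} {k₂} {k₃} σ τ congX congY j₂< k₂< k₃< t₁ t₂ t₃ n₁ n₂ n₃)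
    regions (outer ρ t₁ n₁) (outer σ t₂ n₂) (inner t₃ n₃) = convex-<-swap
        (inner-outer-outer {j₃} {j₂} {j₁} {k₃} {k₂} {k₁} σ ρ (cong-swap {u = X j₁} congX) (cong-swap {u = Y k₁} congY) j₂< k₂< k₁< t₃ t₂ t₁ n₃ n₂ n₁)
    regions (outer ρ t₁ n₁) (outer σ t₂ n₂) (outer τ t₃ n₃) =
      outer-outer-outer {j₁} {j₂} {j₃} {k₁} {k₂} {k₃} ρ σ τ congX congY k₁< k₂< k₃< t₁ t₂ t₃ n₁ n₂ n₃

-- Families of weighted group elements

addMod-cong : ∀ {k} (x y z : Fin k) → addMod x z ≡ addMod y y → Cong k (toℕ x + toℕ z) (toℕ y + toℕ y)
-- Each side receives the quotient of the other, so both become the common remainder plus the same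
-- two multiples.
addMod-cong {suc k} x y z eq = wraps (b / suc k) (a / suc k) (begin
  a + b / suc k * suc k                             ≡⟨ cong (_+ b / suc k * suc k) (m≡m%n+[m/n]*n a (suc k)) ⟩
  a % suc k + a / suc k * suc k + b / suc k * suc k ≡⟨ cong (λ r →
    r + a / suc k * suc k + b / suc k * suc k) a%≡b% ⟩
  b % suc k + a / suc k * suc k + b / suc k * suc k ≡⟨ lemma (b % suc k) (a / suc k * suc k) (b / suc k * suc k) ⟩
  b % suc k + b / suc k * suc k + a / suc k * suc k ≡⟨ cong (_+ a / suc k * suc k) (m≡m%n+[m/n]*n b (suc k)) ⟨
  b + a / suc k * suc k                             ∎)
  where
  open ≡-Reasoning
  a = toℕ x + toℕ z
  b = toℕ y + toℕ y
  a%≡b% : a % suc k ≡ b % suc k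
  a%≡b% = trans (sym (toℕ-fromℕ< (m%n<n a (suc k)))) (trans (cong toℕ eq) (toℕ-fromℕ< (m%n<n b (suc k))))
  lemma : ∀ r p q → r + p + q ≡ r + q + p
  lemma = solve-∀

-- Items are kept apart from group elements because the latter are functions, compared pointwise.
-- Propositional equality of items survives products, and `injective` translates back.
record Family {n} (ms : Fin n → ℕ) (bound : ℕ) : Set₁ where
  field
    Item      : Set
    items     : List Item
    element   : Item → Grp n ms
    value     : Item → ℕ
    value-≤   : ∀ i → value i ≤ bound
    unique    : Unique items
    injective : ∀ {i j} → (∀ a → element i a ≡ element j a) → i ≡ j
    convex    : ∀ {i j k} → i ∈ items → j ∈ items → k ∈ items →
                (∀ a → addMod (element i a) (element k a) ≡ addMod (element j a) (element j a)) →
                Convex (value i) (value j) (value k) (i ≡ k)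

open Family

size : ∀ {n} {ms : Fin n → ℕ} {V} → Family ms V → ℕ
size F = length (items F)

loosen : ∀ {n} {ms : Fin n → ℕ} {V W} → V ≤ W → Family ms V → Family ms W
loosen V≤W F = record
  { Item = Item F ; items = items F ; element = element F ; value = value F
  ; value-≤ = λ i → ≤-trans (value-≤ F i) V≤W
  ; unique = unique F ; injective = injective F ; convex = convex F }

trivial : (ms : Fin 0 → ℕ) → Family ms 0
trivial ms = record
  { Item = ⊤ ; items = tt ∷ [] ; element = λ _ () ; value = λ _ → 0
  ; value-≤ = λ _ → z≤n ; unique = [] AllPairs.∷ AllPairs.[]
  ; injective = λ _ → refl ; convex = λ _ _ _ _ → z≤n , λ _ → refl }

-- The classical choice for a single coordinate: sums of two residues from the lower half do not
-- wrap, so squares serve as weights.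
half : (ms : Fin 1 → ℕ) → Family ms (ms Fin.zero * ms Fin.zero)
half ms = record
  { Item = Fin ⌈ m /2⌉ ; items = allFin ⌈ m /2⌉
  ; element = λ { i Fin.zero → point i }
  ; value = λ i → toℕ i * toℕ i
  ; value-≤ = λ i → *-mono-≤ (toℕ≤m i) (toℕ≤m i)
  ; unique = Unique.allFin⁺ ⌈ m /2⌉
  ; injective = λ eq → toℕ-injective (trans (sym (toℕ-point _)) (trans (cong toℕ (eq Fin.zero)) (toℕ-point _)))
  ; convex = λ {i} {j} {k} _ _ _ eq →
    convex-map toℕ-injective (midpoint-convex (toℕ i) (toℕ j) (toℕ k) (middle i j k (eq Fin.zero)))
  }
  where
  m = ms Fin.zero
  point : Fin ⌈ m /2⌉ → Fin m
  point i = inject≤ i (⌈n/2⌉≤n m)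
  toℕ-point : ∀ i → toℕ (point i) ≡ toℕ i
  toℕ-point i = toℕ-inject≤ i (⌈n/2⌉≤n m)
  toℕ≤m : ∀ (i : Fin ⌈ m /2⌉) → toℕ i ≤ m
  toℕ≤m i = ≤-trans (<⇒≤ (toℕ<n i)) (⌈n/2⌉≤n m)
  sum-<m : ∀ (i k : Fin ⌈ m /2⌉) → toℕ i + toℕ k < m
  -- The two successors absorb the extra unit in 2⌈m/2⌉ ≤ m + 1, so the half may be rounded up.
  sum-<m i k = s≤s⁻¹ (begin
    suc (suc (toℕ i + toℕ k))      ≡⟨ +-suc (suc (toℕ i)) (toℕ k) ⟨
    suc (toℕ i) + suc (toℕ k)      ≤⟨ +-mono-≤ (toℕ<n i) (toℕ<n k) ⟩
    ⌈ m /2⌉ + ⌈ m /2⌉              ≤⟨ +-monoʳ-≤ ⌈ m /2⌉ (⌊n/2⌋≤⌈n/2⌉ (suc m)) ⟩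
    ⌊ suc m /2⌋ + ⌈ suc m /2⌉      ≡⟨ ⌊n/2⌋+⌈n/2⌉≡n (suc m) ⟩
    suc m                          ∎)
    where open ≤-Reasoning
  middle : ∀ i j k → addMod (point i) (point k) ≡ addMod (point j) (point j) → toℕ i + toℕ k ≡ toℕ j + toℕ j
  middle i j k eq = cong-≡ congruent
    (<-≤-trans (sum-<m i k) (m≤n+m m (toℕ j + toℕ j))) (<-≤-trans (sum-<m j j) (m≤n+m m (toℕ i + toℕ k)))
    where
    congruent : Cong m (toℕ i + toℕ k) (toℕ j + toℕ j)
    congruent = subst₂ (Cong m) (cong₂ _+_ (toℕ-point i) (toℕ-point k)) (cong₂ _+_ (toℕ-point j) (toℕ-point j))
      (addMod-cong (point i) (point j) (point k) eq)

half-size : (ms : Fin 1 → ℕ) → ms Fin.zero ≤ 2 * size (half ms)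
half-size ms = begin
  m                          ≡⟨ ⌊n/2⌋+⌈n/2⌉≡n m ⟨
  ⌊ m /2⌋ + ⌈ m /2⌉          ≤⟨ +-monoˡ-≤ ⌈ m /2⌉ (⌊n/2⌋≤⌈n/2⌉ m) ⟩
  ⌈ m /2⌉ + ⌈ m /2⌉          ≡⟨ cong (⌈ m /2⌉ +_) (+-identityʳ ⌈ m /2⌉) ⟨
  2 * ⌈ m /2⌉                ≡⟨ cong (2 *_) (length-tabulate {n = ⌈ m /2⌉} id) ⟨
  2 * length (allFin ⌈ m /2⌉) ∎
  where
  open ≤-Reasoning
  m = ms Fin.zero

module _ {n} {ms : Fin (2 + n) → ℕ} {V W}
         (F : Family (λ i → ms (i ↑ˡ n)) V) (G : Family (λ i → ms (2 ↑ʳ i)) W) where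

  private
    join : Item F × Item G → Grp (2 + n) ms
    join (i , j) Fin.zero              = element F i Fin.zero
    join (i , j) (Fin.suc Fin.zero)    = element F i (Fin.suc Fin.zero)
    join (i , j) (Fin.suc (Fin.suc a)) = element G j a

  _⊗_ : Family ms (V + W)
  _⊗_ = record
    { Item = Item F × Item G
    ; items = cartesianProduct (items F) (items G)
    ; element = join
    ; value = λ (i , j) → value F i + value G j
    ; value-≤ = λ (i , j) → +-mono-≤ (value-≤ F i) (value-≤ G j)
    ; unique = Unique.cartesianProduct⁺ (unique F) (unique G)
    ; injective = λ eq → cong₂ _,_
        (injective F λ { Fin.zero → eq Fin.zero ; (Fin.suc Fin.zero) → eq (Fin.suc Fin.zero) })
        (injective G λ a → eq (Fin.suc (Fin.suc a)))
    ; convex = λ i∈ j∈ k∈ eq → convex-map (λ (p , q) → cong₂ _,_ p q) (convex-+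
        (convex F (proj₁ (split i∈)) (proj₁ (split j∈)) (proj₁ (split k∈))
          λ { Fin.zero → eq Fin.zero ; (Fin.suc Fin.zero) → eq (Fin.suc Fin.zero) })
        (convex G (proj₂ (split i∈)) (proj₂ (split j∈)) (proj₂ (split k∈)) λ a → eq (Fin.suc (Fin.suc a))))
    }
    where
    split : ∀ {p} → p ∈ cartesianProduct (items F) (items G) → proj₁ p ∈ items F × proj₂ p ∈ items G
    split = ∈-cartesianProduct⁻ (items F) (items G)

length-cartesianProduct : ∀ {A B : Set} (xs : List A) (ys : List B) →
  length (cartesianProduct xs ys) ≡ length xs * length ys
length-cartesianProduct []       ys = refl
length-cartesianProduct (x ∷ xs) ys = trans (length-++ (map (x ,_) ys))
  (cong₂ _+_ (length-map (x ,_) ys) (length-cartesianProduct xs ys))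

-- Averaging over translates

∑-grid : ∀ N₁ N₂ m₁ m₂ .{{_ : NonZero m₁}} .{{_ : NonZero m₂}} (g : ℕ → ℕ → ℕ) →
  ∑ N₁ (λ s₁ → ∑ N₂ (λ s₂ → ∑ m₁ (λ j → ∑ m₂ (λ k → g ((N₁ * j + s₁) / m₁) ((N₂ * k + s₂) / m₂)))))
  ≡ m₁ * (m₂ * ∑ N₁ (λ c → ∑ N₂ (g c)))
∑-grid N₁ N₂ m₁ m₂ g = begin
  ∑ N₁ (λ s₁ → ∑ N₂ (λ s₂ → ∑ m₁ (λ j → ∑ m₂ (λ k → g ((N₁ * j + s₁) / m₁) ((N₂ * k + s₂) / m₂)))))
    ≡⟨ ∑-cong N₁ (λ s₁ _ → ∑-swap N₂ m₁ (λ s₂ j → ∑ m₂ (λ k → g ((N₁ * j + s₁) / m₁) ((N₂ * k + s₂) / m₂)))) ⟩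
  ∑ N₁ (λ s₁ → ∑ m₁ (λ j → ∑ N₂ (λ s₂ → ∑ m₂ (λ k → g ((N₁ * j + s₁) / m₁) ((N₂ * k + s₂) / m₂)))))
    ≡⟨ ∑-cong N₁ (λ s₁ _ → ∑-cong m₁ λ j _ → ∑-shifts N₂ m₂ (g ((N₁ * j + s₁) / m₁))) ⟩
  ∑ N₁ (λ s₁ → ∑ m₁ (λ j → m₂ * ∑ N₂ (g ((N₁ * j + s₁) / m₁))))
    ≡⟨ ∑-shifts N₁ m₁ (λ c → m₂ * ∑ N₂ (g c)) ⟩
  m₁ * ∑ N₁ (λ c → m₂ * ∑ N₂ (g c))
    ≡⟨ cong (m₁ *_) (∑-* N₁ m₂ (λ c → ∑ N₂ (g c))) ⟩
  m₁ * (m₂ * ∑ N₁ (λ c → ∑ N₂ (g c))) ∎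
  where open ≡-Reasoning

-- By `∑-grid` the density averaged over all shifts is that of the cells, and the best shift is at
-- least average.
dense-shift : ∀ N₁ N₂ m₁ m₂ .{{_ : NonZero N₁}} .{{_ : NonZero N₂}} .{{_ : NonZero m₁}} .{{_ : NonZero m₂}}
  (g : ℕ → ℕ → ℕ) a b → a * (N₁ * N₂) ≤ b * ∑ N₁ (λ c → ∑ N₂ (g c)) →
  ∃ λ s₁ → ∃ λ s₂ → s₁ < N₁ × s₂ < N₂ ×
    a * (m₁ * m₂) ≤ b * ∑ m₁ (λ j → ∑ m₂ (λ k → g ((N₁ * j + s₁) / m₁) ((N₂ * k + s₂) / m₂)))
dense-shift N₁ N₂ m₁ m₂ g a b dense
  with ∑-max₂ N₁ N₂ (λ s₁ s₂ → ∑ m₁ (λ j → ∑ m₂ (λ k → g ((N₁ * j + s₁) / m₁) ((N₂ * k + s₂) / m₂))))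
... | s₁ , s₂ , s₁< , s₂< , best = s₁ , s₂ , s₁< , s₂< , *-cancelʳ-≤ _ _ (N₁ * N₂) {{m*n≢0 N₁ N₂}} (begin
  a * (m₁ * m₂) * (N₁ * N₂)      ≡⟨ lemma₁ a m₁ m₂ (N₁ * N₂) ⟩
  m₁ * (m₂ * (a * (N₁ * N₂)))    ≤⟨ *-monoʳ-≤ m₁ (*-monoʳ-≤ m₂ dense) ⟩
  m₁ * (m₂ * (b * W))            ≡⟨ lemma₂ b m₁ m₂ W ⟩
  b * (m₁ * (m₂ * W))            ≡⟨ cong (b *_) (∑-grid N₁ N₂ m₁ m₂ g) ⟨
  b * _                          ≤⟨ *-monoʳ-≤ b best ⟩
  b * (N₁ * (N₂ * _))            ≡⟨ lemma₃ b N₁ N₂ _ ⟩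
  b * _ * (N₁ * N₂)              ∎)
  where
  open ≤-Reasoning
  W = ∑ N₁ (λ c → ∑ N₂ (g c))
  lemma₁ : ∀ a m₁ m₂ N → a * (m₁ * m₂) * N ≡ m₁ * (m₂ * (a * N))
  lemma₁ = solve-∀
  lemma₂ : ∀ b m₁ m₂ W → m₁ * (m₂ * (b * W)) ≡ b * (m₁ * (m₂ * W))
  lemma₂ = solve-∀
  lemma₃ : ∀ b N₁ N₂ c → b * (N₁ * (N₂ * c)) ≡ b * c * (N₁ * N₂)
  lemma₃ = solve-∀

module _ (ms : Fin 2 → ℕ) (m : ℕ) (range : ∀ i → 2 ≤ ms i × ms i ≤ m) where

  private
    m₁ = ms Fin.zero
    m₂ = ms (Fin.suc Fin.zero)

    instance
      m₁≢0 : NonZero m₁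
      m₁≢0 = >-nonZero (<-≤-trans z<s (proj₁ (range Fin.zero)))
      m₂≢0 : NonZero m₂
      m₂≢0 = >-nonZero (<-≤-trans z<s (proj₁ (range (Fin.suc Fin.zero))))

  module _ (s₁ s₂ : ℕ) (s₂<240 : s₂ < 240) where

    open Pair m₁ m₂ m s₁ s₂ (proj₂ (range Fin.zero)) (proj₂ (range (Fin.suc Fin.zero))) s₂<240

    private
      here? : (p : Fin m₁ × Fin m₂) → Dec (Region (col (toℕ (proj₁ p))) (row (toℕ (proj₂ p))))
      here? (j , k) = region? (col (toℕ j)) (row (toℕ k))

      weigh : ∀ j k → Dec (Region (col j) (row k)) → ℕ
      weigh j k (yes r) = weight j k r
      -- A placeholder: such points are filtered out of `chosen`.
      weigh j k (no _)  = 0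

      weigh-≤ : ∀ {j k} → j < m₁ → k < m₂ → (d : Dec (Region (col j) (row k))) → weigh j k d ≤ 4000 * M
      weigh-≤ j< k< (yes r) = weight-≤ j< k< r
      weigh-≤ j< k< (no _)  = z≤n

      -- The weight refers to a proof of membership. Since `weight-convex` accepts arbitrary proofs,
      -- it is enough that the recorded value comes from some proof.
      weigh-region : ∀ {j k} (d : Dec (Region (col j) (row k))) → Region (col j) (row k) → ∃ λ r →
        weigh j k d ≡ weight j k r
      weigh-region (yes r) _ = r , refl
      weigh-region (no ¬r) r = ⊥-elim (¬r r)

      chosen : List (Fin m₁ × Fin m₂)
      chosen = filter here? (cartesianProduct (allFin m₁) (allFin m₂))

      point : Fin m₁ × Fin m₂ → Grp 2 ms
      point (j , k) Fin.zero           = j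
      point (j , k) (Fin.suc Fin.zero) = k

      weightOf : Fin m₁ × Fin m₂ → ℕ
      weightOf p = weigh (toℕ (proj₁ p)) (toℕ (proj₂ p)) (here? p)

    shifted : Family ms (4000 * M)
    shifted = record
      { Item = Fin m₁ × Fin m₂
      ; items = chosen
      ; element = point
      ; value = weightOf
      ; value-≤ = λ (j , k) → weigh-≤ (toℕ<n j) (toℕ<n k) (here? (j , k))
      ; unique = Unique.filter⁺ here? (Unique.cartesianProduct⁺ (Unique.allFin⁺ m₁) (Unique.allFin⁺ m₂))
      ; injective = λ eq → cong₂ _,_ (eq Fin.zero) (eq (Fin.suc Fin.zero))
      ; convex = convexity
      }
      where
      placed : ∀ {p} → p ∈ chosen →
        ∃ λ r → weightOf p ≡ weight (toℕ (proj₁ p)) (toℕ (proj₂ p)) r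
      placed {p} p∈ = weigh-region (here? p) (proj₂ (∈-filter⁻ here? {xs = cartesianProduct (allFin m₁) (allFin m₂)} p∈))
      convexity : ∀ {p q r} → p ∈ chosen → q ∈ chosen → r ∈ chosen →
        (∀ a → addMod (point p a) (point r a) ≡ addMod (point q a) (point q a)) →
        Convex (weightOf p) (weightOf q) (weightOf r) (p ≡ r)
      convexity {j₁ , k₁} {j₂ , k₂} {j₃ , k₃} p∈ q∈ r∈ eq =
        convex-resp (proj₂ (placed p∈)) (proj₂ (placed q∈)) (proj₂ (placed r∈))
          (convex-map (λ (j≡ , k≡) → cong₂ _,_ (toℕ-injective j≡) (toℕ-injective k≡))
            (weight-convex (toℕ<n j₁) (toℕ<n j₂) (toℕ<n j₃) (toℕ<n k₁) (toℕ<n k₂) (toℕ<n k₃)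
              (addMod-cong j₁ j₂ j₃ (eq Fin.zero)) (addMod-cong k₁ k₂ k₃ (eq (Fin.suc Fin.zero)))
              (proj₁ (placed p∈)) (proj₁ (placed q∈)) (proj₁ (placed r∈))))

    shifted-size : size shifted ≡ ∑ m₁ (λ j → ∑ m₂ (λ k → cell (col j) (row k)))
    shifted-size = length-filter-cartesianProduct here? m₁ m₂ id id _ (λ _ _ → refl)

  pair : Σ (Family ms (4000 * (m * m))) λ F → 7 * (m₁ * m₂) ≤ 24 * size F
  pair = choose (dense-shift 400 240 m₁ m₂ cell 7 24 cells-dense)
    where
    choose : (∃ λ s₁ → ∃ λ s₂ → s₁ < 400 × s₂ < 240 ×
        7 * (m₁ * m₂) ≤ 24 * ∑ m₁ (λ j → ∑ m₂ (λ k → cell ((400 * j + s₁) / m₁) ((240 * k + s₂) / m₂)))) →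
      Σ (Family ms (4000 * (m * m))) λ F → 7 * (m₁ * m₂) ≤ 24 * size F
    choose (s₁ , s₂ , _ , s₂< , dense) = shifted s₁ s₂ s₂< ,
      subst (λ c → 7 * (m₁ * m₂) ≤ 24 * c) (sym (shifted-size s₁ s₂ s₂<)) dense

-- Squared because (7/24)^(n/2) is irrational for odd n. The factor 2 compensates for `half`, whose
-- density can be as low as 1/2, below the square root of 7/24.
Dense : ∀ {n} {ms : Fin n → ℕ} {V} → Family ms V → Set
Dense {n} {ms} F = 7 ^ n * prodFin n ms ^ 2 ≤ 24 ^ n * (2 * size F) ^ 2

half-dense : (ms : Fin 1 → ℕ) → Dense (half ms)
half-dense ms = begin
  7 * 1 * ((ms Fin.zero * 1) ^ 2)      ≤⟨ *-mono-≤ (≤ᵇ⇒≤ 7 24 _) (^-monoˡ-≤ 2 (≤-trans (≤-reflexive (*-identityʳ (ms Fin.zero))) (half-size ms))) ⟩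
  24 * 1 * (2 * size (half ms)) ^ 2    ∎
  where open ≤-Reasoning

⊗-dense : ∀ {n} (ms : Fin (2 + n) → ℕ) {V W} (F : Family (λ i → ms (i ↑ˡ n)) V) (G : Family (λ i →
  ms (2 ↑ʳ i)) W) →
  7 * (ms Fin.zero * ms (Fin.suc Fin.zero)) ≤ 24 * size F → Dense G → Dense {ms = ms} (F ⊗ G)
⊗-dense {n} ms F G F-dense G-dense = begin
  7 * (7 * 7 ^ n) * (a * (b * P)) ^ 2       ≡⟨ lemma₁ (7 ^ n) a b P ⟩
  (7 * (a * b)) ^ 2 * (7 ^ n * P ^ 2)       ≤⟨ *-mono-≤ (^-monoˡ-≤ 2 F-dense) G-dense ⟩
  (24 * f) ^ 2 * (24 ^ n * (2 * g) ^ 2)     ≡⟨ lemma₂ (24 ^ n) f g ⟩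
  24 * (24 * 24 ^ n) * (2 * (f * g)) ^ 2    ≡⟨ cong (λ s →
    24 * (24 * 24 ^ n) * (2 * s) ^ 2) (length-cartesianProduct (items F) (items G)) ⟨
  24 * (24 * 24 ^ n) * (2 * size (_⊗_ {ms = ms} F G)) ^ 2 ∎
  where
  open ≤-Reasoning
  a = ms Fin.zero
  b = ms (Fin.suc Fin.zero)
  P = prodFin n (λ i → ms (2 ↑ʳ i))
  f = size F
  g = size G
  lemma₁ : ∀ s a b P → 7 * (7 * s) * ((a * (b * P)) * ((a * (b * P)) * 1)) ≡ (7 * (a * b)) * ((7 * (a * b)) * 1) * (s * (P * (P * 1)))
  lemma₁ = solve-∀
  lemma₂ : ∀ t f g → (24 * f) * ((24 * f) * 1) * (t * ((2 * g) * ((2 * g) * 1))) ≡ 24 * (24 * t) * ((2 * (f * g)) * ((2 * (f * g)) * 1))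
  lemma₂ = solve-∀

module _ (m C : ℕ) (4000m²≤C : 4000 * (m * m) ≤ C) where

  combine : ∀ {n} (ms : Fin (2 + n) → ℕ) →
    (Σ (Family (λ i → ms (i ↑ˡ n)) (4000 * (m * m))) λ F →
      7 * (ms Fin.zero * ms (Fin.suc Fin.zero)) ≤ 24 * size F) →
    Σ (Family (λ i → ms (2 ↑ʳ i)) (n * C)) Dense → Σ (Family ms ((2 + n) * C)) Dense
  combine {n} ms (F , F-dense) (G , G-dense) = loosen bound (_⊗_ {ms = ms} F G) , ⊗-dense ms F G F-dense G-dense
    where
    bound : 4000 * (m * m) + n * C ≤ C + (C + n * C)
    bound = +-mono-≤ 4000m²≤C (m≤n+m (n * C) C)

  -- Coordinates are removed two at a time, so `half` enters at most once, for the last coordinate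
  -- when n is odd; hence a single factor 2 in `Dense` is enough.
  family : ∀ n (ms : Fin n → ℕ) → (∀ i → 2 ≤ ms i × ms i ≤ m) → Σ (Family ms (n * C)) Dense
  family zero          ms range = trivial ms , ≤ᵇ⇒≤ 1 4 _
  family (suc zero)    ms range = loosen bound (half ms) , half-dense ms
    where
    bound : ms Fin.zero * ms Fin.zero ≤ C + 0
    bound = begin
      ms Fin.zero * ms Fin.zero   ≤⟨ *-mono-≤ (proj₂ (range Fin.zero)) (proj₂ (range Fin.zero)) ⟩
      m * m                       ≤⟨ m≤n*m (m * m) 4000 ⟩
      4000 * (m * m)              ≤⟨ 4000m²≤C ⟩
      C                           ≤⟨ m≤m+n C 0 ⟩
      C + 0                       ∎
      where open ≤-Reasoning
  family (suc (suc n)) ms range = combine ms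
    (pair (λ i → ms (i ↑ˡ n)) m (λ i → range (i ↑ˡ n))) (family n (λ i → ms (2 ↑ʳ i)) (λ i → range (2 ↑ʳ i)))

-- Level sets and the final count

module _ {n} {ms : Fin n → ℕ} {V} (F : Family ms V) where

  level : ℕ → List (Item F)
  level k = filter (λ i → value F i ≟ k) (items F)

  largest-level : ∃ λ k → size F ≤ suc V * length (level k)
  largest-level with ∑-max (suc V) (length ∘ level)
  ... | k , _ , best = k , ≤-trans (≤-reflexive (sym (∑-fibres (value F) (suc V) (items F) (s≤s ∘ value-≤ F)))) best

  level-subset : ∀ k → IsSubset {n} {ms} (map (element F) (level k))
  level-subset k = AllPairs.map⁺ (AllPairs.map (λ i≢j eq → i≢j (injective F eq))
    (Unique.filter⁺ (λ i → value F i ≟ k) (unique F)))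

  -- On a level set the convexity inequality is an equality, which forces the endpoints of a
  -- progression to coincide.
  level-free : ∀ k → ThreeAPFree {n} {ms} (map (element F) (level k))
  level-free k x y z x∈ y∈ z∈ _ _ x≉z eq with ∈-map⁻ (element F) x∈ | ∈-map⁻ (element F) y∈ | ∈-map⁻ (element F) z∈
  ... | i , i∈ , refl | j , j∈ , refl | l , l∈ , refl = x≉z λ a → cong (λ i → element F i a)
    (Convex.equality (convex F (proj₁ (member i∈)) (proj₁ (member j∈)) (proj₁ (member l∈)) eq)
      (≤-reflexive (cong₂ _+_ (same i∈ j∈) (same l∈ j∈))))
    where
    member : ∀ {i} → i ∈ level k → i ∈ items F × value F i ≡ k
    member = ∈-filter⁻ (λ i → value F i ≟ k) {xs = items F}
    same : ∀ {i j} → i ∈ level k → j ∈ level k → value F i ≡ value F j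
    same i∈ j∈ = trans (proj₂ (member i∈)) (sym (proj₂ (member j∈)))

-- The left side is twice the number of levels, the 2 coming from `Dense`. Both the successor and
-- the passage from n to n³ are absorbed using m, n ≥ 1.
levels-≤ : ∀ n m C t .{{_ : NonZero n}} .{{_ : NonZero m}} → 2 * (C + 1) ≤ t →
  2 * suc (n * (C * (m * m))) ≤ t * (m * m * (n * (n * n)))
levels-≤ n m C t 2C+2≤t = begin
  2 * suc (n * (C * q))      ≡⟨ lemma₁ n C q ⟩
  2 * C * (q * n) + 2 * 1    ≤⟨ +-mono-≤ (*-monoʳ-≤ (2 * C) (*-monoʳ-≤ q n≤z)) (*-monoʳ-≤ 2 1≤qz) ⟩
  2 * C * (q * z) + 2 * (q * z) ≡⟨ lemma₂ C (q * z) ⟩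
  2 * (C + 1) * (q * z)      ≤⟨ *-monoˡ-≤ (q * z) 2C+2≤t ⟩
  t * (q * z)                ∎
  where
  open ≤-Reasoning
  q = m * m
  z = n * (n * n)
  n≤z : n ≤ z
  n≤z = m≤m*n n (n * n) {{m*n≢0 n n}}
  1≤qz : 1 ≤ q * z
  1≤qz = *-mono-≤ (>-nonZero⁻¹ (m * m) {{m*n≢0 m m}}) (≤-trans (>-nonZero⁻¹ n) n≤z)
  lemma₁ : ∀ n C q → 2 * suc (n * (C * q)) ≡ 2 * C * (q * n) + 2 * 1
  lemma₁ = solve-∀
  lemma₂ : ∀ C r → 2 * C * r + 2 * r ≡ 2 * (C + 1) * r
  lemma₂ = solve-∀

count-≤ : ∀ n m C t {s a} .{{_ : NonZero n}} .{{_ : NonZero m}} → 2 * (C + 1) ≤ t →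
  s ≤ suc (n * (C * (m * m))) * a → 2 * s ≤ a * t * m ^ 2 * n ^ 3
count-≤ n m C t {s} {a} 2C+2≤t s≤ = begin
  2 * s                                   ≤⟨ *-monoʳ-≤ 2 s≤ ⟩
  2 * (suc (n * (C * (m * m))) * a)       ≡⟨ *-assoc 2 (suc (n * (C * (m * m)))) a ⟨
  2 * suc (n * (C * (m * m))) * a         ≤⟨ *-monoˡ-≤ a (levels-≤ n m C t 2C+2≤t) ⟩
  t * (m * m * (n * (n * n))) * a         ≡⟨ lemma n m t a ⟩
  a * t * m ^ 2 * n ^ 3                   ∎
  where
  open ≤-Reasoning
  lemma : ∀ n m t a → t * (m * m * (n * (n * n))) * a ≡ a * t * (m * (m * 1)) * (n * (n * (n * 1)))
  lemma = solve-∀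

theorem1p3 : (n : ℕ) → 1 ≤ n → (ms : Fin n → ℕ) → (m : ℕ) →
    (∀ i → 2 ≤ ms i × ms i ≤ m) →
    Σ (List (Grp n ms)) λ A → IsSubset {n} {ms} A × ThreeAPFree {n} {ms} A ×
    7 ^ n * (prodFin n ms ^ 2) ≤ 24 ^ n * ((length A * 10 ^ 6 * m ^ 2 * n ^ 3) ^ 2)
theorem1p3 n@(suc _) 1≤n ms m range = conclude (family m (4000 * (m * m)) ≤-refl n ms range)
  where
  instance
    m≢0 : NonZero m
    m≢0 = >-nonZero (<-≤-trans z<s (≤-trans (proj₁ (range Fin.zero)) (proj₂ (range Fin.zero))))
  conclude : Σ (Family ms (n * (4000 * (m * m)))) Dense → Σ (List (Grp n ms)) λ A →
    IsSubset {n} {ms} A × ThreeAPFree {n} {ms} A ×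
    7 ^ n * (prodFin n ms ^ 2) ≤ 24 ^ n * ((length A * 10 ^ 6 * m ^ 2 * n ^ 3) ^ 2)
  conclude (F , dense) = A , level-subset F k , level-free F k ,
    -- With `C = 4000`, twice the number of levels is at most 8002 m² n³, well under 10⁶ m² n³.
    ≤-trans dense (*-monoʳ-≤ (24 ^ n) (^-monoˡ-≤ 2 (count-≤ n m 4000 (10 ^ 6) (≤ᵇ⇒≤ (2 * 4001) (10 ^ 6) _) size-≤)))
    where
    k : ℕ
    k = proj₁ (largest-level F)
    A : List (Grp n ms)
    A = map (element F) (level F k)
    size-≤ : size F ≤ suc (n * (4000 * (m * m))) * length A
    size-≤ = subst (λ a → size F ≤ suc (n * (4000 * (m * m))) * a) (sym (length-map (element F) (level F k))) (proj₂ (largest-level F))
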